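{- Let $\mathscr{R}$ be an o-minimal expansion of $(\mathbb{R},<,+)$, let $\mathscr{N}$ be a highly saturated elementary extension of $\mathscr{R}$ with domain $N$, let $H$ be a dense independent subset of $N$, and let $\mathscr{H}$ be the structure induced on $H$ by $\mathscr{N}$. Then the Shelah expansion $\mathscr{H}^{\mathrm{Sh}}$ of $\mathscr{H}$ interprets $\mathscr{R}$.
   Context: All structures are first order. "Definable" means first order definable, possibly with parameters; likewise interpretations may use parameters. "Highly saturated" means $\kappa$-saturated for a sufficiently large cardinal $\kappa$ (in particular larger than the cardinality of the structure being extended and of its language). A subset $H$ of an o-minimal structure $\mathscr{N}$ is independent if it is independent in the sense of algebraic closure (equivalently, definable closure) in $\mathscr{N}$, i.e. no $h \in H$ lies in the algebraic closure of $H \setminus \{h\}$. "Dense" means dense in $N$ with respect to the order topology. For a structure $\mathscr{M}$ with domain $M$ and a set $A \subseteq M^m$, the structure induced on $A$ by $\mathscr{M}$ is the structure with domain $A$ whose primitive $n$-ary relations are all sets of the form $X \cap A^n$ for $\mathscr{M}$-definable $X \subseteq M^{nm}$. In particular, the primitive $n$-ary relations of $\mathscr{H}$ are all sets $X \cap H^n$ with $X \subseteq N^n$ definable in $\mathscr{N}$ (with parameters from $N$). For a structure $\mathscr{M}$ with domain $M$, the Shelah expansion $\mathscr{M}^{\mathrm{Sh}}$ of $\mathscr{M}$ is the structure induced on $M$ by a highly saturated elementary extension $\mathscr{M}^*$ of $\mathscr{M}$; that is, its primitive $n$-ary relations are the externally definable sets, namely the sets $X \cap M^n$ with $X \subseteq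 (M^*)^n$ definable in $\mathscr{M}^*$ with parameters from $M^*$. By saturation, the collection of externally definable sets does not depend on the choice of $\mathscr{M}^*$. Here $\mathscr{H}^{\mathrm{Sh}}$ is formed using a highly saturated elementary extension of $\mathscr{H}$. -}

module Defs where

open import Level using (Level; _⊔_; 0ℓ) renaming (suc to lsuc)
open import Data.Empty using (⊥)
open import Data.Fin.Base using (Fin; zero; suc)
open import Data.List.Base using (List)
open import Data.List.Relation.Unary.All using (All)
open import Data.List.Relation.Unary.Any using (Any)
open import Data.Nat.Base as ℕ using (ℕ)
open import Data.Product.Base using (Σ; ∃; ∃₂; _×_; _,_; proj₁; proj₂)
open import Data.Rational.Base as ℚ using (ℚ)
import Data.Rational.Properties as ℚ
open import Data.Sum.Base using (_⊎_)
open import Data.Vec.Functional using (Vector; []; _∷_; head; tail; concat)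
open import Data.Vec.Functional.Relation.Binary.Pointwise using (Pointwise)
open import Function.Base using (_∘_; id)
open import Function.Bundles using (Func; Injection; _⇔_)
open import Relation.Binary.Bundles using (Setoid)
open import Relation.Binary.Core using (Rel)
open import Relation.Binary.Definitions using (tri<; tri≈; tri>)
open import Relation.Binary.PropositionalEquality.Core
  using (_≡_; refl; sym; trans; cong; subst)
open import Relation.Binary.PropositionalEquality.Properties using (setoid)
import Relation.Binary.Construct.Add.Extrema.Strict as Extrema
import Relation.Binary.Construct.On as On
open import Relation.Nullary.Construct.Add.Extrema using (_±; [_])
open import Relation.Nullary.Negation.Core using (¬_)
open import Relation.Unary using (Pred; _∈_; _∉_; _≐_)

private
  variable
    a c c′ e e′ f ℓ r s s′ : Level
    n : ℕ

∣_∣ : Setoid c e → Set c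
∣ D ∣ = Setoid.Carrier D

-- Equality is a logical symbol, interpreted by the
-- equality of the setoid that serves as the domain.

record Language (f r : Level) : Set (lsuc (f ⊔ r)) where
  field
    FunSym : ℕ → Set f
    RelSym : ℕ → Set r

Symbols : Language f r → Setoid (f ⊔ r) (f ⊔ r)
Symbols L = setoid (∃ (Language.FunSym L) ⊎ ∃ (Language.RelSym L))

-- Formula L A n consists of the L-formulas with free variables among
-- 0, …, n - 1 and with names for the elements of A as extra constants.

data Term (L : Language f r) (A : Set a) (n : ℕ) : Set (f ⊔ a) where
  var : Fin n → Term L A n
  par : A → Term L A n
  app : ∀ {k} → Language.FunSym L k → Vector (Term L A n) k → Term L A n

infixr 5 _⇒′_
infix 6 _≈′_

-- The other connectives and ∃ are classically definable from these.  The
-- variable bound by ∀′ is variable 0 of its scope.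

data Formula (L : Language f r) (A : Set a) : ℕ → Set (f ⊔ r ⊔ a) where
  ⊥′   : Formula L A n
  _≈′_ : Term L A n → Term L A n → Formula L A n
  rel′ : ∀ {k} → Language.RelSym L k → Vector (Term L A n) k → Formula L A n
  _⇒′_ : Formula L A n → Formula L A n → Formula L A n
  ∀′   : Formula L A (ℕ.suc n) → Formula L A n

record Structure (L : Language f r) (D : Setoid c e) (s : Level)
                 : Set (f ⊔ r ⊔ c ⊔ e ⊔ lsuc s) where
  open Setoid D using (Carrier; _≈_)
  field
    fun      : Language.FunSym L n → Vector Carrier n → Carrier
    rel      : Language.RelSym L n → Vector Carrier n → Set s
    fun-cong : ∀ (F : Language.FunSym L n) {u v} →
               Pointwise _≈_ u v → fun F u ≈ fun F v
    rel-resp : ∀ (P : Language.RelSym L n) {u v} →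
               Pointwise _≈_ u v → rel P u → rel P v

module _ {L : Language f r} {D : Setoid c e} (M : Structure L D s)
         {A : Set a} (name : A → ∣ D ∣) where

  value : Term L A n → Vector ∣ D ∣ n → ∣ D ∣
  value (var i)    v = v i
  value (par x)    v = name x
  value (app F ts) v = Structure.fun M F (λ i → value (ts i) v)

  Sat : Formula L A n → Vector ∣ D ∣ n → Set (c ⊔ e ⊔ s)
  Sat ⊥′          v = Level.Lift _ ⊥
  Sat (t ≈′ u)    v = Level.Lift (c ⊔ s) (Setoid._≈_ D (value t v) (value u v))
  Sat (rel′ P ts) v = Level.Lift (c ⊔ e) (Structure.rel M P (λ i → value (ts i) v))
  Sat (φ ⇒′ ψ)    v = Sat φ v → Sat ψ v
  Sat (∀′ φ)      v = ∀ x → Sat φ (x ∷ v)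

module _ {L : Language f r} {D : Setoid c e} (M : Structure L D s)
         {A : Set a} (name : A → ∣ D ∣) where
  open Setoid D using (_≈_)

  value-cong : (t : Term L A n) {u v : Vector ∣ D ∣ n} →
               Pointwise _≈_ u v → value M name t u ≈ value M name t v
  value-cong (var i)    u≈v = u≈v i
  value-cong (par x)    u≈v = Setoid.refl D
  value-cong (app F ts) u≈v =
    Structure.fun-cong M F (λ i → value-cong (ts i) u≈v)

  Sat-cong : (φ : Formula L A n) {u v : Vector ∣ D ∣ n} →
             Pointwise _≈_ u v → Sat M name φ u → Sat M name φ v
  Sat-cong ⊥′          u≈v (Level.lift ())
  Sat-cong (t ≈′ t′)   u≈v (Level.lift p) = Level.lift
    (Setoid.trans D (Setoid.sym D (value-cong t u≈v))
      (Setoid.trans D p (value-cong t′ u≈v)))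
  Sat-cong (rel′ P ts) u≈v (Level.lift p) = Level.lift
    (Structure.rel-resp M P (λ i → value-cong (ts i) u≈v) p)
  Sat-cong (φ ⇒′ ψ)    u≈v p q =
    Sat-cong ψ u≈v (p (Sat-cong φ (λ i → Setoid.sym D (u≈v i)) q))
  Sat-cong (∀′ φ)      u≈v p x =
    Sat-cong φ (λ { zero → Setoid.refl D ; (suc i) → u≈v i }) (p x)

-- M is an expansion of M₀ when the symbols of L₀ occur among those of L
-- (via funMap and relMap) with the same interpretation.

record Expansion {f₀ r₀ s₀} {L₀ : Language f₀ r₀} {L : Language f r}
                 {D : Setoid c e} (M₀ : Structure L₀ D s₀) (M : Structure L D s)
                 : Set (f₀ ⊔ r₀ ⊔ s₀ ⊔ f ⊔ r ⊔ s ⊔ c ⊔ e) where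
  open Setoid D using (_≈_)
  field
    funMap   : Language.FunSym L₀ n → Language.FunSym L n
    relMap   : Language.RelSym L₀ n → Language.RelSym L n
    fun-same : ∀ (F : Language.FunSym L₀ n) v →
               Structure.fun M (funMap F) v ≈ Structure.fun M₀ F v
    rel-same : ∀ (P : Language.RelSym L₀ n) v →
               Structure.rel M (relMap P) v ⇔ Structure.rel M₀ P v

record ElementaryExtension {L : Language f r} {D : Setoid c e} {D′ : Setoid c′ e′}
                           (M : Structure L D s) (N : Structure L D′ s′)
                           : Set (f ⊔ r ⊔ c ⊔ e ⊔ s ⊔ c′ ⊔ e′ ⊔ s′) where
  field
    embed      : Func D D′
    elementary : ∀ (φ : Formula L ⊥ n) v →
                 Sat M (λ ()) φ v ⇔ Sat N (λ ()) φ (Func.to embed ∘ v)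

-- A cardinal is represented by a setoid having that many
-- elements up to equality.

_≼_ : Setoid c e → Setoid c′ e′ → Set (c ⊔ e ⊔ c′ ⊔ e′)
X ≼ Y = Injection X Y

_≺_ : Setoid c e → Setoid c′ e′ → Set (c ⊔ e ⊔ c′ ⊔ e′)
X ≺ Y = X ≼ Y × ¬ (Y ≼ X)

Sub : (D : Setoid c e) → Pred ∣ D ∣ ℓ → Setoid (c ⊔ ℓ) e
Sub D A = record
  { Carrier       = ∃ A
  ; _≈_           = λ x y → Setoid._≈_ D (proj₁ x) (proj₁ y)
  ; isEquivalence = On.isEquivalence proj₁ (Setoid.isEquivalence D)
  }

-- By excluded middle nothing is lost by taking the parameter set A and the
-- set p of formulas at level zero.

Saturated : {L : Language f r} {D : Setoid c e} →
            Setoid c′ e′ → Structure L D s → Set _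
Saturated {L = L} {D = D} κ M =
  (A : Pred ∣ D ∣ 0ℓ) → Sub D A ≺ κ →
  (p : Pred (Formula L (∃ A) 1) 0ℓ) →
  (∀ φs → All p φs → ∃ λ x → All (λ φ → Sat M proj₁ φ (x ∷ [])) φs) →
  ∃ λ x → ∀ φ → p φ → Sat M proj₁ φ (x ∷ [])

-- N is κ-saturated for an infinite κ exceeding the cardinality of M and
-- of the language of M.

record HighlySaturatedOver {k₁ k₂} {L : Language f r} {D : Setoid c e}
                           {D′ : Setoid c′ e′} (κ : Setoid k₁ k₂)
                           (M : Structure L D s) (N : Structure L D′ s′)
                           : Set (lsuc 0ℓ ⊔ f ⊔ r ⊔ c ⊔ e ⊔ c′ ⊔ e′ ⊔ s′ ⊔ k₁ ⊔ k₂)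
                           where
  field
    infinite       : setoid ℕ ≼ κ
    above-domain   : D ≺ κ
    above-language : Symbols L ≺ κ
    saturated      : Saturated κ N

-- A piece is a point or an open interval with endpoints in D ∪ {±∞}.

InInterval : {D : Set c} → Rel D ℓ → D ± × D ± → Pred D (c ⊔ ℓ)
InInterval _<_ (l , u) x = l <± [ x ] × [ x ] <± u
  where open Extrema _<_ using (_<±_)

data Piece (D : Set c) : Set c where
  point    : D → Piece D
  interval : D ± × D ± → Piece D

InPiece : (D : Setoid c e) → Rel ∣ D ∣ ℓ → Piece ∣ D ∣ → Pred ∣ D ∣ (c ⊔ e ⊔ ℓ)
InPiece {c} {e} {ℓ} D _<_ (point y)    x = Level.Lift (c ⊔ ℓ) (Setoid._≈_ D x y)
InPiece {c} {e} {ℓ} D _<_ (interval I) x = Level.Lift e (InInterval _<_ I x)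

-- For a structure M on a domain linearly ordered by _<_.

OMinimal : {L : Language f r} {D : Setoid c e} →
           Structure L D s → Rel ∣ D ∣ ℓ → Set _
OMinimal {L = L} {D = D} M _<_ =
  (φ : Formula L ∣ D ∣ 1) →
  ∃ λ (ps : List (Piece ∣ D ∣)) →
  ∀ x → Sat M id φ (x ∷ []) ⇔ Any (λ p → InPiece D _<_ p x) ps

-- Open intervals with endpoints in D ∪ {±∞} are a base of the order
-- topology.

Dense : {D : Set c} → Rel D ℓ → Pred D a → Set _
Dense _<_ H = ∀ I → ∃ (InInterval _<_ I) → ∃ λ h → H h × InInterval _<_ I h

module _ {L : Language f r} {D : Setoid c e} (M : Structure L D s) where
  open Setoid D using (Carrier; _≈_)

  acl : Pred Carrier a → Pred Carrier _
  acl A x = Σ (Formula L (∃ A) 1) λ φ →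
    Sat M proj₁ φ (x ∷ []) ×
    ∃ λ (ys : List Carrier) → ∀ y → Sat M proj₁ φ (y ∷ []) → Any (y ≈_) ys

  Independent : Pred Carrier a → Set _
  Independent H = ∀ h → h ∈ H → h ∉ acl (λ x → H x × ¬ (x ≈ h))

-- The n-ary relation symbols are the formulas in n variables with
-- parameters from M, that is, the M-definable subsets of Mⁿ up to
-- repetition.  The subset of M is given as the image of ι.

InducedLanguage : (L : Language f r) (D : Setoid c e) → Language 0ℓ (f ⊔ r ⊔ c)
InducedLanguage L D = record
  { FunSym = λ _ → ⊥
  ; RelSym = Formula L ∣ D ∣
  }

Induced : {L : Language f r} {D : Setoid c e} {D′ : Setoid c′ e′} →
          Structure L D s → Func D′ D → Structure (InducedLanguage L D) D′ (c ⊔ e ⊔ s)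
Induced M ι = record
  { fun      = λ ()
  ; rel      = λ φ v → Sat M id φ (Func.to ι ∘ v)
  ; fun-cong = λ ()
  ; rel-resp = λ φ u≈v → Sat-cong M id φ (λ i → Func.cong ι (u≈v i))
  }

inclusion : (D : Setoid c e) (A : Pred ∣ D ∣ ℓ) → Func (Sub D A) D
inclusion D A = record { to = proj₁ ; cong = id }

InducedOn : {L : Language f r} {D : Setoid c e} (M : Structure L D s)
            (A : Pred ∣ D ∣ ℓ) → Structure (InducedLanguage L D) (Sub D A) (c ⊔ e ⊔ s)
InducedOn {D = D} M A = Induced M (inclusion D A)

-- The Shelah expansion of M, computed in the elementary extension M*; to
-- be used for a highly saturated M*.

Shelah : {L : Language f r} {D : Setoid c e} {D* : Setoid c′ e′}
         (M : Structure L D s) (M* : Structure L D* s′) →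
         ElementaryExtension M M* → Structure (InducedLanguage L D*) D (c′ ⊔ e′ ⊔ s′)
Shelah M M* j = Induced M* (ElementaryExtension.embed j)

-- Interpretation with parameters: a surjection coord from a definable set of m-tuples onto
-- R under which the preimages of equality, of the primitive relations and
-- of the graphs of the primitive functions of R are M-definable.

record Interprets {f′ r′} {L : Language f r} {D : Setoid c e}
                  {L′ : Language f′ r′} {D′ : Setoid c′ e′}
                  (M : Structure L D s) (R : Structure L′ D′ s′)
                  : Set (f ⊔ r ⊔ c ⊔ e ⊔ s ⊔ f′ ⊔ r′ ⊔ c′ ⊔ e′ ⊔ s′) where
  open Setoid D′ using () renaming (_≈_ to _≈ᴿ_)
  field
    m          : ℕ
    dom        : Formula L ∣ D ∣ m
    coord      : (x : Vector ∣ D ∣ m) → Sat M id dom x → ∣ D′ ∣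
    surjective : ∀ y → ∃₂ λ x x∈ → coord x x∈ ≈ᴿ y

  DefinablePreimage : Pred (Vector ∣ D′ ∣ n) ℓ → Set _
  DefinablePreimage {n = n} X =
    ∃ λ (φ : Formula L ∣ D ∣ (n ℕ.* m)) →
    ∀ (x : Vector (Vector ∣ D ∣ m) n) (x∈ : ∀ i → Sat M id dom (x i)) →
    X (λ i → coord (x i) (x∈ i)) ⇔ Sat M id φ (concat x)

  field
    equality  : DefinablePreimage {n = 2} (λ y → y zero ≈ᴿ y (suc zero))
    relations : ∀ (P : Language.RelSym L′ n) → DefinablePreimage (Structure.rel R P)
    functions : ∀ (F : Language.FunSym L′ n) →
                DefinablePreimage (λ y → Structure.fun R F (tail y) ≈ᴿ head y)

-- The ordered group of real numbers, as Dedekind cuts given by their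
-- lower sets.  Classically (there is no locatedness condition) these are
-- exactly the real numbers.

record ℝ : Set₁ where
  field
    lower     : Pred ℚ 0ℓ
    inhabited : ∃ λ q → q ∈ lower
    bounded   : ∃ λ q → q ∉ lower
    downward  : ∀ {p q} → p ℚ.< q → q ∈ lower → p ∈ lower
    noMax     : ∀ {p} → p ∈ lower → ∃ λ q → p ℚ.< q × q ∈ lower

open ℝ

ℝ-setoid : Setoid (lsuc 0ℓ) 0ℓ
ℝ-setoid = record
  { Carrier       = ℝ
  ; _≈_           = λ x y → lower x ≐ lower y
  ; isEquivalence = record
    { refl  = id , id
    ; sym   = λ (p , q) → q , p
    ; trans = λ (p , q) (p′ , q′) → p′ ∘ p , q ∘ q′
    }
  }

open Setoid ℝ-setoid using () renaming (_≈_ to _≈ℝ_)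

_<ℝ_ : Rel ℝ 0ℓ
x <ℝ y = ∃ λ q → q ∉ lower x × q ∈ lower y

private
  below : ∀ (x : ℝ) {p q} → p ∈ lower x → q ∉ lower x → p ℚ.< q
  below x {p} {q} p∈ q∉ with ℚ.<-cmp p q
  ... | tri< p<q _ _ = p<q
  ... | tri≈ _ refl _ with () ← q∉ p∈
  ... | tri> _ _ q<p with () ← q∉ (downward x q<p p∈)

  r≡[r-q]+q : ∀ r q → r ≡ (r ℚ.- q) ℚ.+ q
  r≡[r-q]+q r q = sym (trans (ℚ.+-assoc r (ℚ.- q) q)
    (trans (cong (r ℚ.+_) (ℚ.+-inverseˡ q)) (ℚ.+-identityʳ r)))

  [p+q]-q≡p : ∀ p q → (p ℚ.+ q) ℚ.- q ≡ p
  [p+q]-q≡p p q = trans (ℚ.+-assoc p q (ℚ.- q))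
    (trans (cong (p ℚ.+_) (ℚ.+-inverseʳ q)) (ℚ.+-identityʳ p))

_+ℝ_ : ℝ → ℝ → ℝ
lower (x +ℝ y) r = ∃₂ λ p q → p ∈ lower x × q ∈ lower y × r ≡ p ℚ.+ q
inhabited (x +ℝ y) with inhabited x | inhabited y
... | p , p∈ | q , q∈ = p ℚ.+ q , p , q , p∈ , q∈ , refl
bounded (x +ℝ y) with bounded x | bounded y
... | s , s∉ | t , t∉ = s ℚ.+ t , λ (p , q , p∈ , q∈ , eq) →
  ℚ.<-irrefl (sym eq) (ℚ.+-mono-< (below x p∈ s∉) (below y q∈ t∉))
downward (x +ℝ y) {r} r<r′ (p , q , p∈ , q∈ , refl) =
  r ℚ.- q , q ,
  downward x (subst (r ℚ.- q ℚ.<_) ([p+q]-q≡p p q) (ℚ.+-monoˡ-< (ℚ.- q) r<r′)) p∈ ,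
  q∈ , r≡[r-q]+q r q
noMax (x +ℝ y) (p , q , p∈ , q∈ , refl) with noMax x p∈
... | p′ , p<p′ , p′∈ = p′ ℚ.+ q , ℚ.+-monoˡ-< q p<p′ , p′ , q , p′∈ , q∈ , refl

data OrderedGroupFun : ℕ → Set where
  plus : OrderedGroupFun 2

data OrderedGroupRel : ℕ → Set where
  less : OrderedGroupRel 2

OrderedGroupLanguage : Language 0ℓ 0ℓ
OrderedGroupLanguage = record { FunSym = OrderedGroupFun ; RelSym = OrderedGroupRel }

ℝ<+ : Structure OrderedGroupLanguage ℝ-setoid 0ℓ
ℝ<+ = record
  { fun      = λ { plus v → v zero +ℝ v (suc zero) }
  ; rel      = λ { less v → v zero <ℝ v (suc zero) }
  ; fun-cong = λ { plus u≈v →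
      (λ (p , q , p∈ , q∈ , eq) →
         p , q , proj₁ (u≈v zero) p∈ , proj₁ (u≈v (suc zero)) q∈ , eq) ,
      (λ (p , q , p∈ , q∈ , eq) →
         p , q , proj₂ (u≈v zero) p∈ , proj₂ (u≈v (suc zero)) q∈ , eq) }
  ; rel-resp = λ { less u≈v (q , q∉ , q∈) →
      q , q∉ ∘ proj₂ (u≈v zero) , proj₁ (u≈v (suc zero)) q∈ }
  }

-- The order of a structure in the language of an expansion R of (ℝ,<,+);
-- in particular of an elementary extension of R.

order : {L : Language f r} {R : Structure L ℝ-setoid s} → Expansion ℝ<+ R →
        {D : Setoid c e} → Structure L D s′ → Rel ∣ D ∣ s′
order E N x y = Structure.rel N (Expansion.relMap E less) (x ∷ y ∷ [])

{-# OPTIONS --safe #-}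
module Submission where

-- The standard part map st sends an element of N bounded by reals to the real with the same
-- rational cut.  Restricted to H it is onto ℝ, because H meets every infinitesimal interval, and
-- it is the coordinate map of the interpretation.
--
-- If X ⊆ ℝⁿ is closed and ∅-definable, then st a ∈ X iff every h ∈ H that exceeds some positive
-- real is larger than the distance from a to some point of X(N).  For fixed X the last clause is a
-- relation between a and h definable in 𝓝, and the set of such h, like the set of bounded elements
-- of H, is given by a cut of H, which a parameter of 𝓗* defines.
--
-- Every ∅-definable X ⊆ ℝᴺ is a Boolean combination of closed ones.  Call F n-closed if its fibres
-- over the coordinates from n on are closed in ℝⁿ; all sets are 0-closed.  Let F be n-closed, let G
-- be its closure in the first n + 1 coordinates, and let P be the set of all points that agree from
-- coordinate n on with a point of G ∖ F.  Then F = (G ∖ P) ∪ (F ∩ P).  By o-minimality and the Baire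
-- category theorem, P is finite in direction n, so that G, P and F ∩ P are (n + 1)-closed.

open import Level using (Level; _⊔_; 0ℓ; lift; lower) renaming (suc to lsuc)
open import Axiom.ExcludedMiddle using (ExcludedMiddle)
open import Relation.Binary.Bundles using (Setoid)
open import Relation.Unary using (Pred)
open import Relation.Binary.Definitions using (_Respects_; tri<; tri≈; tri>)
open import Defs

open import Data.Empty using (⊥; ⊥-elim)
open import Data.Fin.Base using (Fin; zero; suc; splitAt; _↑ˡ_; _↑ʳ_; toℕ; fromℕ<; combine)
import Data.Fin.Properties as Fin
open import Data.Integer.Base as ℤ using (ℤ; +_; -[1+_])
import Data.Integer.Properties as ℤ
open import Data.List.Base as List using (List)
open import Data.List.Relation.Unary.All as All using (All)
open import Data.List.Relation.Unary.Any using (Any; here; there)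
open import Data.Nat.Base as ℕ using (ℕ)
import Data.Nat.Coprimality as Coprime
import Data.Nat.Properties as ℕ
open import Data.Product.Base using (∃; ∃₂; _×_; _,_; proj₁; proj₂)
open import Data.Rational.Base as ℚ using (ℚ; mkℚ)
import Data.Rational.Properties as ℚ
open import Data.Rational.Solver using (module +-*-Solver)
import Data.Rational.Unnormalised.Base as ℚᵘ
import Data.Rational.Unnormalised.Properties as ℚᵘ
open import Data.Sum.Base using (_⊎_; inj₁; inj₂)
open import Data.Vec.Base as Vec using (Vec)
open import Data.Vec.Functional using (Vector; []; _∷_; _++_; concat)
open import Data.Vec.Functional.Properties using (lookup-++ˡ; lookup-++ʳ)
import Data.Vec.Properties as Vec
open import Function.Base using (_∘_; id)
open import Function.Bundles using (Func; _⇔_; mk⇔; module Equivalence)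
import Function.Construct.Composition as Compose
import Relation.Binary.Construct.Add.Extrema.Strict as Extrema
open import Relation.Binary.PropositionalEquality
  using (_≡_; refl; sym; trans; cong; cong₂; subst; subst₂)
open import Relation.Nullary using (¬_; Dec; yes; no)
open import Relation.Nullary.Construct.Add.Extrema using ([_])
open import Relation.Nullary.Decidable using (decidable-stable; True; toWitness; fromWitness)

open Equivalence using (to; from)
open ℝ renaming (lower to cut)
open Setoid ℝ-setoid using ()
  renaming (_≈_ to _≈ℝ_; refl to ≈ℝ-refl; sym to ≈ℝ-sym; trans to ≈ℝ-trans)

private
  variable
    a b c c′ e e′ f ℓ p r s s′ k₁ k₂ : Level
    cN eN sN h c* e* s* k₁* k₂* f′ r′ : Level
    A B : Set a
    P : Set p
    n m k N : ℕ
    L : Language f r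
    D : Setoid c e

-- Classical logic

module Classical (em : ∀ ℓ → ExcludedMiddle ℓ) where

  abstract

    dne : ¬ ¬ P → P
    dne = decidable-stable (em _)

    ¬∀⇒∃¬ : {P : A → Set p} → ¬ (∀ x → P x) → ∃ λ x → ¬ P x
    ¬∀⇒∃¬ ¬∀ = dne λ ¬∃ → ¬∀ λ x → dne λ ¬p → ¬∃ (x , ¬p)

  -- By excluded middle every proposition is equivalent to one at level zero. Cuts of reals and the
  -- parameter sets and types in `Saturated` must live there, while their natural definitions need
  -- not.
  Resized : Set p → Set
  Resized P = True (em _ {P})

  resize : P → Resized P
  resize = fromWitness

  unresize : Resized P → P
  unresize = toWitness

  -- Formulas and satisfaction

  infixr 5.5 _∧′_
  infix 7 ¬′_

  ¬′_ : Formula L A n → Formula L A n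
  ¬′ φ = φ ⇒′ ⊥′

  _∧′_ : Formula L A n → Formula L A n → Formula L A n
  φ ∧′ ψ = ¬′ (φ ⇒′ ¬′ ψ)

  ∃′ : Formula L A (ℕ.suc n) → Formula L A n
  ∃′ φ = ¬′ ∀′ (¬′ φ)

  -- `P` is decided outside the formula. This lets a conjunction over all of `Fin N` constrain only
  -- some of the coordinates.
  guard : Dec P → Formula L A n → Formula L A n
  guard (yes _) φ = φ
  guard (no _)  φ = ¬′ ⊥′

  ⋀ : (Fin k → Formula L A n) → Formula L A n
  ⋀ {k = ℕ.zero}  φ = ¬′ ⊥′
  ⋀ {k = ℕ.suc k} φ = φ zero ∧′ ⋀ (φ ∘ suc)

  ∃ⁿ : ∀ k → Formula L A (k ℕ.+ n) → Formula L A n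
  ∃ⁿ ℕ.zero    φ = φ
  ∃ⁿ (ℕ.suc k) φ = ∃ⁿ k (∃′ φ)

  module _ {L : Language f r} (g : A → B) where

    sub-term : (Fin n → Term L B m) → Term L A n → Term L B m
    sub-term σ (var i)    = σ i
    sub-term σ (par x)    = par (g x)
    sub-term σ (app F ts) = app F λ i → sub-term σ (ts i)

  lift-sub : {L : Language f r} {A : Set a} →
             (Fin n → Term L A m) → Fin (ℕ.suc n) → Term L A (ℕ.suc m)
  lift-sub σ zero    = var zero
  lift-sub σ (suc i) = sub-term id (var ∘ suc) (σ i)

  -- Names are translated along with the variables; with `g = λ ()` a parameter-free formula passes
  -- into a language with names.
  sub : {L : Language f r} (g : A → B) → (Fin n → Term L B m) → Formula L A n → Formula L B m
  sub g σ ⊥′          = ⊥′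
  sub g σ (t ≈′ u)    = sub-term g σ t ≈′ sub-term g σ u
  sub g σ (rel′ P ts) = rel′ P λ i → sub-term g σ (ts i)
  sub g σ (φ ⇒′ ψ)    = sub g σ φ ⇒′ sub g σ ψ
  sub g σ (∀′ φ)      = ∀′ (sub g (lift-sub σ) φ)

  ++-uncons : ∀ (w : Vector A (ℕ.suc k)) (v : Vector A n) i →
              (w ++ v) i ≡ (w zero ∷ ((w ∘ suc) ++ v)) i
  ++-uncons         w v zero    = refl
  ++-uncons {k = k} w v (suc i) with splitAt k i
  ... | inj₁ _ = refl
  ... | inj₂ _ = refl

  -- A wrapper for Sat from which the formula can be inferred.

  record Holds {L : Language f r} {D : Setoid c e} (M : Structure L D s) {A : Set a} (nm : A → ∣ D ∣)
               (v : Vector ∣ D ∣ n) (φ : Formula L A n) : Set (c ⊔ e ⊔ s) where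
    constructor sat
    field
      unsat : Sat M nm φ v

  open Holds

  module _ {L : Language f r} {D : Setoid c e} {M : Structure L D s} {A : Set a} {nm : A → ∣ D ∣} where
    private module D = Setoid D

    abstract

      Holds-cong : {φ : Formula L A n} {v w : Vector ∣ D ∣ n} → (∀ i → v i D.≈ w i) →
                   Holds M nm v φ → Holds M nm w φ
      Holds-cong {φ = φ} v≈w (sat p) = sat (Sat-cong M nm φ v≈w p)

      ≈-holds : {t u : Term L A n} {v : Vector ∣ D ∣ n} →
                Holds M nm v (t ≈′ u) ⇔ value M nm t v D.≈ value M nm u v
      ≈-holds = mk⇔ (lower ∘ unsat) (sat ∘ lift)

      module _ {φ : Formula L A n} {v : Vector ∣ D ∣ n} where

        ¬-holds : Holds M nm v (¬′ φ) ⇔ (¬ Holds M nm v φ)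
        ¬-holds = mk⇔ (λ (sat p) (sat q) → ⊥-elim (lower (p q))) (λ p → sat λ q → ⊥-elim (p (sat q)))

        guard-holds : (P? : Dec P) → Holds M nm v (guard P? φ) ⇔ (P → Holds M nm v φ)
        guard-holds (yes p) = mk⇔ (λ q _ → q) (λ f → f p)
        guard-holds (no ¬p) = mk⇔ (λ _ p → ⊥-elim (¬p p)) (λ _ → sat id)

        ⇒-holds : {ψ : Formula L A n} → Holds M nm v (φ ⇒′ ψ) ⇔ (Holds M nm v φ → Holds M nm v ψ)
        ⇒-holds = mk⇔ (λ (sat p) (sat q) → sat (p q)) (λ p → sat λ q → unsat (p (sat q)))

        ∧-holds : {ψ : Formula L A n} → Holds M nm v (φ ∧′ ψ) ⇔ (Holds M nm v φ × Holds M nm v ψ)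
        ∧-holds = mk⇔ (λ (sat p) → dne λ q → lower (p λ x y → ⊥-elim (q (sat x , sat y))))
                      (λ (sat x , sat y) → sat λ p → p x y)

      ∀-holds : {φ : Formula L A (ℕ.suc n)} {v : Vector ∣ D ∣ n} →
                Holds M nm v (∀′ φ) ⇔ (∀ x → Holds M nm (x ∷ v) φ)
      ∀-holds = mk⇔ (λ (sat p) x → sat (p x)) (λ p → sat λ x → unsat (p x))

      ∃-holds : {φ : Formula L A (ℕ.suc n)} {v : Vector ∣ D ∣ n} →
                Holds M nm v (∃′ φ) ⇔ (∃ λ x → Holds M nm (x ∷ v) φ)
      ∃-holds = mk⇔ (λ (sat p) → dne λ q → lower (p λ x y → ⊥-elim (q (x , sat y))))
                    (λ (x , sat y) → sat λ p → p x y)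

      ⋀-holds : {φ : Fin k → Formula L A n} {v : Vector ∣ D ∣ n} →
                Holds M nm v (⋀ φ) ⇔ (∀ i → Holds M nm v (φ i))
      ⋀-holds {k = ℕ.zero}  = mk⇔ (λ _ ()) (λ _ → sat id)
      ⋀-holds {k = ℕ.suc k} = mk⇔
        (λ p → λ { zero → proj₁ (to ∧-holds p) ; (suc i) → to ⋀-holds (proj₂ (to ∧-holds p)) i })
        (λ p → from ∧-holds (p zero , from ⋀-holds (p ∘ suc)))

      ∃ⁿ-holds : ∀ k {φ : Formula L A (k ℕ.+ n)} {v : Vector ∣ D ∣ n} →
                 Holds M nm v (∃ⁿ k φ) ⇔ (∃ λ w → Holds M nm (w ++ v) φ)
      ∃ⁿ-holds ℕ.zero    = mk⇔ (λ (sat p) → [] , sat p) (λ (_ , sat p) → sat p)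
      ∃ⁿ-holds (ℕ.suc k) {v = v} = mk⇔
        (λ p → let w , q = to (∃ⁿ-holds k) p; x , y = to ∃-holds q in
               x ∷ w , Holds-cong (λ i → D.reflexive (sym (++-uncons (x ∷ w) v i))) y)
        (λ (w , p) → from (∃ⁿ-holds k) (w ∘ suc , from ∃-holds
          (w zero , Holds-cong (λ i → D.reflexive (++-uncons w v i)) p)))

  module _ {L : Language f r} {D : Setoid c e} (M : Structure L D s) {A : Set a} (nm : A → ∣ D ∣) where
    open Setoid D using (_≈_)

    module _ {B : Set b} (nm′ : B → ∣ D ∣) (g : A → B) (nm≈ : ∀ x → nm′ (g x) ≈ nm x) where

      value-sub : (t : Term L A n) {σ : Fin n → Term L B m} {v : Vector ∣ D ∣ m} →
                  value M nm′ (sub-term g σ t) v ≈ value M nm t (λ i → value M nm′ (σ i) v)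
      value-sub (var i)    = Setoid.refl D
      value-sub (par x)    = nm≈ x
      value-sub (app F ts) = Structure.fun-cong M F λ i → value-sub (ts i)

  module _ {L : Language f r} {D : Setoid c e} (M : Structure L D s) {A : Set a} (nm : A → ∣ D ∣) where
    open Setoid D using (_≈_)

    value-lift : {σ : Fin n → Term L A m} {v : Vector ∣ D ∣ m} {x : ∣ D ∣} → ∀ i →
                 value M nm (lift-sub σ i) (x ∷ v) ≈ (x ∷ (λ i → value M nm (σ i) v)) i
    value-lift         zero    = Setoid.refl D
    value-lift {σ = σ} (suc i) = value-sub M nm nm id (λ _ → Setoid.refl D) (σ i)

  module _ {L : Language f r} {D : Setoid c e} (M : Structure L D s)
           {A : Set a} (nm : A → ∣ D ∣) {B : Set b} (nm′ : B → ∣ D ∣) (g : A → B)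
           (nm≈ : ∀ x → Setoid._≈_ D (nm′ (g x)) (nm x)) where
    private open module D = Setoid D using (_≈_)

    Sat-sub : (φ : Formula L A n) {σ : Fin n → Term L B m} {v : Vector ∣ D ∣ m} →
              Sat M nm′ (sub g σ φ) v ⇔ Sat M nm φ (λ i → value M nm′ (σ i) v)
    Sat-sub ⊥′          = mk⇔ (λ ()) (λ ())
    Sat-sub (t ≈′ u)    = mk⇔
      (λ (lift p) → lift (D.trans (D.sym (vs t)) (D.trans p (vs u))))
      (λ (lift p) → lift (D.trans (vs t) (D.trans p (D.sym (vs u)))))
      where vs = λ t → value-sub M nm nm′ g nm≈ t
    Sat-sub (rel′ P ts) = mk⇔
      (λ (lift p) → lift (Structure.rel-resp M P (λ i → vs (ts i)) p))
      (λ (lift p) → lift (Structure.rel-resp M P (λ i → D.sym (vs (ts i))) p))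
      where vs = λ t → value-sub M nm nm′ g nm≈ t
    Sat-sub (φ ⇒′ ψ)    = mk⇔
      (λ p q → to (Sat-sub ψ) (p (from (Sat-sub φ) q)))
      (λ p q → from (Sat-sub ψ) (p (to (Sat-sub φ) q)))
    Sat-sub (∀′ φ)      = mk⇔
      (λ p x → Sat-cong M nm φ (value-lift M nm′) (to (Sat-sub φ) (p x)))
      (λ p x → from (Sat-sub φ) (Sat-cong M nm φ (λ i → D.sym (value-lift M nm′ i)) (p x)))

    abstract

      sub-holds : {φ : Formula L A n} {σ : Fin n → Term L B m} {v : Vector ∣ D ∣ m} →
                  Holds M nm′ v (sub g σ φ) ⇔ Holds M nm (λ i → value M nm′ (σ i) v) φ
      sub-holds {φ = φ} = mk⇔ (sat ∘ to (Sat-sub φ) ∘ unsat) (sat ∘ from (Sat-sub φ) ∘ unsat)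

  closure : Formula L A n → Formula L A 0
  closure {n = ℕ.zero}  φ = φ
  closure {n = ℕ.suc n} φ = closure (∀′ φ)

  module _ {L : Language f r} {D : Setoid c e} {M : Structure L D s} where
    private module D = Setoid D

    abstract

      rename-holds : {nm : A → ∣ D ∣} {φ : Formula L ⊥ n} {σ : Fin n → Term L A m}
                           {v : Vector ∣ D ∣ m} {w : Vector ∣ D ∣ n} →
                     (∀ i → value M nm (σ i) v D.≈ w i) →
                     Holds M nm v (sub (λ ()) σ φ) ⇔ Holds M (λ ()) w φ
      rename-holds {nm = nm} σv≈w = mk⇔
        (λ p → Holds-cong σv≈w (to (sub-holds M (λ ()) nm (λ ()) (λ ())) p))
        (λ p → from (sub-holds M (λ ()) nm (λ ()) (λ ())) (Holds-cong (λ i → D.sym (σv≈w i)) p))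

      closure-holds : {nm : A → ∣ D ∣} {φ : Formula L A n} →
            Holds M nm [] (closure φ) ⇔ (∀ v → Holds M nm v φ)
      closure-holds {n = ℕ.zero}  = mk⇔ (λ p v → Holds-cong (λ ()) p) (λ p → p [])
      closure-holds {n = ℕ.suc n} = mk⇔
        (λ p v → Holds-cong (λ { zero → D.refl ; (suc i) → D.refl })
                (to ∀-holds (to closure-holds p (v ∘ suc)) (v zero)))
        (λ p → from closure-holds λ v → from ∀-holds λ x → p (x ∷ v))

  -- Real numbers

  ∈∉⇒< : ∀ (x : ℝ) {p q} → cut x p → ¬ cut x q → p ℚ.< q
  ∈∉⇒< x {p} {q} p∈ q∉ with ℚ.<-cmp p q
  ... | tri< p<q _ _ = p<q
  ... | tri≈ _ refl _ = ⊥-elim (q∉ p∈)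
  ... | tri> _ _ q<p = ⊥-elim (q∉ (downward x q<p p∈))

  p<p+ε : ∀ p {ε} → ℚ.0ℚ ℚ.< ε → p ℚ.< p ℚ.+ ε
  p<p+ε p {ε} 0<ε = subst (ℚ._< p ℚ.+ ε) (ℚ.+-identityʳ p) (ℚ.+-monoʳ-< p 0<ε)

  [p-q]+q≡p : ∀ p q → (p ℚ.- q) ℚ.+ q ≡ p
  [p-q]+q≡p p q = trans (ℚ.+-assoc p (ℚ.- q) q)
    (trans (cong (p ℚ.+_) (ℚ.+-inverseˡ q)) (ℚ.+-identityʳ p))

  0<1ℚ : ℚ.0ℚ ℚ.< ℚ.1ℚ
  0<1ℚ = ℚ.positive⁻¹ ℚ.1ℚ

  fromℚ : ℚ → ℝ
  fromℚ q = record
    { lower     = ℚ._< q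
    ; inhabited = q ℚ.- ℚ.1ℚ , subst (q ℚ.- ℚ.1ℚ ℚ.<_) ([p-q]+q≡p q ℚ.1ℚ) (p<p+ε (q ℚ.- ℚ.1ℚ) 0<1ℚ)
    ; bounded   = q , ℚ.<-irrefl refl
    ; downward  = ℚ.<-trans
    ; noMax     = λ p<q → let r , p<r , r<q = ℚ.<-dense p<q in r , p<r , r<q
    }

  -- x <ℝ y unfolds to a type from which x and y cannot be inferred.

  record _<_ (x y : ℝ) : Set where
    constructor mk
    field
      get : x <ℝ y

  open _<_

  <-irrefl : ∀ {x y} → x ≈ℝ y → ¬ x < y
  <-irrefl (_ , y⊆x) (mk (q , q∉ , q∈)) = q∉ (y⊆x q∈)

  <-trans : ∀ {x y z} → x < y → y < z → x < z
  <-trans {y = y} {z} (mk (q , q∉x , q∈y)) (mk (r , r∉y , r∈z)) =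
    mk (q , q∉x , downward z (∈∉⇒< y q∈y r∉y) r∈z)

  <-asym : ∀ {x y} → x < y → ¬ y < x
  <-asym {x} x<y y<x = <-irrefl {x} {x} (≈ℝ-refl {x}) (<-trans {x} x<y y<x)

  <-resp : ∀ {x x′ y y′} → x ≈ℝ x′ → y ≈ℝ y′ → x < y → x′ < y′
  <-resp (_ , x′⊆x) (y⊆y′ , _) (mk (q , q∉ , q∈)) = mk (q , q∉ ∘ x′⊆x , y⊆y′ q∈)

  ≮-antisym : ∀ {x y} → ¬ x < y → ¬ y < x → x ≈ℝ y
  ≮-antisym x≮y y≮x =
    (λ q∈ → dne λ q∉ → y≮x (mk (_ , q∉ , q∈))) , (λ q∈ → dne λ q∉ → x≮y (mk (_ , q∉ , q∈)))

  <-cmp : ∀ x y → x < y ⊎ x ≈ℝ y ⊎ y < x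
  <-cmp x y with em _ {x < y} | em _ {y < x}
  ... | yes x<y | _       = inj₁ x<y
  ... | no _    | yes y<x = inj₂ (inj₂ y<x)
  ... | no x≮y  | no y≮x  = inj₂ (inj₁ (≮-antisym {x} {y} x≮y y≮x))

  <⊎≮⇒< : ∀ {x y z} → x < y → ¬ z < y → x < z
  <⊎≮⇒< {x} {y} {z} x<y z≮y with <-cmp y z
  ... | inj₁ y<z        = <-trans {x} x<y y<z
  ... | inj₂ (inj₁ y≈z) = <-resp {x} {x} {y} {z} (≈ℝ-refl {x}) y≈z x<y
  ... | inj₂ (inj₂ z<y) = ⊥-elim (z≮y z<y)

  ∈⇒fromℚ< : ∀ (x : ℝ) {q} → cut x q → fromℚ q < x
  ∈⇒fromℚ< x q∈ = mk (_ , ℚ.<-irrefl refl , q∈)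

  fromℚ<⇒∈ : ∀ (x : ℝ) {q} → fromℚ q < x → cut x q
  fromℚ<⇒∈ x (mk (s , s≮q , s∈)) = dne λ q∉ → s≮q (∈∉⇒< x s∈ q∉)

  ∉⇒<fromℚ : ∀ (x : ℝ) {q r} → ¬ cut x q → q ℚ.< r → x < fromℚ r
  ∉⇒<fromℚ x q∉ q<r = mk (_ , q∉ , q<r)

  fromℚ-mono-< : ∀ {p q} → p ℚ.< q → fromℚ p < fromℚ q
  fromℚ-mono-< {p} {q} = ∈⇒fromℚ< (fromℚ q) {p}

  abstract

    between : ∀ {x y} → x < y → ∃ λ q → x < fromℚ q × fromℚ q < y
    -- The real `x` may equal `q`, so strictness on the left needs a larger rational in the cut of
    -- `y`.
    between {x} {y} (mk (q , q∉ , q∈)) = let r , q<r , r∈ = noMax y q∈ in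
      r , ∉⇒<fromℚ x q∉ q<r , ∈⇒fromℚ< y r∈

    below : ∀ x → ∃ λ q → fromℚ q < x
    below x = let q , q∈ = inhabited x in q , ∈⇒fromℚ< x q∈

    above : ∀ x → ∃ λ q → x < fromℚ q
    above x = let q , q∉ = bounded x in q ℚ.+ ℚ.1ℚ , ∉⇒<fromℚ x q∉ (p<p+ε q 0<1ℚ)

    maximum-below : ∀ {x y z} → x < z → y < z →
                    ∃ λ m → m < z × (∀ {w} → m < w → x < w × y < w)
    maximum-below {x} {y} x<z y<z with em _ {x < y}
    ... | yes x<y = y , y<z , λ {w} y<w → <-trans {x} {y} {w} x<y y<w , y<w
    ... | no x≮y  = x , x<z , λ {w} x<w → x<w , dne λ y≮w →
      x≮y (<⊎≮⇒< {x} {w} {y} x<w y≮w)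

    minimum-above : ∀ {x y z} → z < x → z < y →
                    ∃ λ m → z < m × (∀ {w} → w < m → w < x × w < y)
    minimum-above {x} {y} z<x z<y with em _ {x < y}
    ... | yes x<y = x , z<x , λ {w} w<x → w<x , <-trans {w} {x} {y} w<x x<y
    ... | no x≮y  = y , z<y , λ {w} w<y → <⊎≮⇒< {w} {y} {x} w<y x≮y , w<y

  -- The point is the supremum of the left endpoints, whose cut is the union of theirs. Because the
  -- endpoints move strictly, it lies inside every open interval.
  nested-intervals : (l u : ℕ → ℝ) → (∀ k → l k < l (ℕ.suc k)) → (∀ k → u (ℕ.suc k) < u k) →
                     (∀ k → l k < u k) → ∃ λ y → ∀ k → l k < y × y < u k
  nested-intervals l u l< u< l<u = y , λ k →
      (let mk (q , q∉ , q∈) = l< k in mk (q , q∉ , ℕ.suc k , q∈)) ,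
      (let mk (q , q∉ , q∈) = u< k in mk (q , (λ (j , q∈l) → q∉ (l⊆u j (ℕ.suc k) q∈l)) , q∈))
    where
    <⇒⊆ : ∀ {x y} → x < y → ∀ {r} → cut x r → cut y r
    <⇒⊆ {x} {y} (mk (q , q∉ , q∈)) r∈ = downward y (∈∉⇒< x r∈ q∉) q∈
    l⊆ : ∀ j d {r} → cut (l j) r → cut (l (d ℕ.+ j)) r
    l⊆ j ℕ.zero    r∈ = r∈
    l⊆ j (ℕ.suc d) r∈ = <⇒⊆ {l (d ℕ.+ j)} {l (ℕ.suc d ℕ.+ j)} (l< (d ℕ.+ j)) (l⊆ j d r∈)
    u⊆ : ∀ j d {r} → cut (u (d ℕ.+ j)) r → cut (u j) r
    u⊆ j ℕ.zero    r∈ = r∈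
    u⊆ j (ℕ.suc d) r∈ = u⊆ j d (<⇒⊆ {u (ℕ.suc d ℕ.+ j)} {u (d ℕ.+ j)} (u< (d ℕ.+ j)) r∈)
    l⊆u : ∀ j k {r} → cut (l j) r → cut (u k) r
    l⊆u j k {r} r∈ = u⊆ k j (subst (λ i → cut (u i) r) (ℕ.+-comm k j)
      (<⇒⊆ {l (k ℕ.+ j)} {u (k ℕ.+ j)} (l<u (k ℕ.+ j)) (l⊆ j k r∈)))
    y : ℝ
    y = record
      { lower     = λ r → ∃ λ k → cut (l k) r
      ; inhabited = let r , r∈ = inhabited (l 0) in r , 0 , r∈
      ; bounded   = let r , r∉ = bounded (u 0) in r , λ (j , r∈) → r∉ (l⊆u j 0 r∈)
      ; downward  = λ p<q (k , q∈) → k , downward (l k) p<q q∈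
      ; noMax     = λ (k , p∈) → let q , p<q , q∈ = noMax (l k) p∈ in q , p<q , k , q∈
      }

  +ℝ-mono-< : ∀ {x y z w} → x < y → z < w → (x +ℝ z) < (y +ℝ w)
  +ℝ-mono-< {x} {z = z} (mk (q , q∉ , q∈)) (mk (r , r∉ , r∈)) = mk (q ℚ.+ r ,
    (λ (p , p′ , p∈ , p′∈ , eq) →
      ℚ.<-irrefl (sym eq) (ℚ.+-mono-< (∈∉⇒< x p∈ q∉) (∈∉⇒< z p′∈ r∉))) ,
    q , r , q∈ , r∈ , refl)

  0ℝ : ℝ
  0ℝ = fromℚ ℚ.0ℚ

  abstract

    gap : ∀ {x y} → x < y → ∃ λ ε → 0ℝ < ε × (x +ℝ ε) < y
    gap {x} {y} (mk (p , p∉ , p∈)) = let q , p<q , q∈ = noMax y p∈ in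
      -- Since `x` is at most `p`, the sum of `x` and `q - p` is at most `q`, which is below `y`.
      fromℚ (q ℚ.- p) ,
      fromℚ-mono-< (subst (ℚ._< q ℚ.- p) (ℚ.+-inverseʳ p) (ℚ.+-monoˡ-< (ℚ.- p) p<q)) ,
      mk (q , (λ (a , b , a∈ , b< , eq) → ℚ.<-irrefl (sym eq)
            (subst (a ℚ.+ b ℚ.<_) (trans (ℚ.+-comm p _) ([p-q]+q≡p q p))
              (ℚ.+-mono-< (∈∉⇒< x a∈ p∉) b<))) ,
      q∈)

  natℚ : ℕ → ℚ
  natℚ n = mkℚ (+ n) 0 (Coprime.sym (Coprime.1-coprimeTo n))

  natℚ-suc : ∀ n → natℚ (ℕ.suc n) ≡ natℚ n ℚ.+ ℚ.1ℚ
  natℚ-suc n = ℚ.toℚᵘ-injective (ℚᵘ.≃-trans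
    (ℚᵘ.*≡* (cong (λ i → i ℤ.* ℤ.1ℤ)
      (trans (cong +_ (sym (ℕ.+-comm n 1))) (cong (ℤ._+ ℤ.1ℤ) (sym (ℤ.*-identityʳ (+ n)))))))
    (ℚᵘ.≃-sym (ℚ.toℚᵘ-homo-+ (natℚ n) ℚ.1ℚ)))

  archimedean : ∀ p → ∃ λ n → p ℚ.< natℚ n
  archimedean (mkℚ (+ n) d-1 _) = ℕ.suc n , ℚ.*<* (subst₂ ℤ._<_
    (sym (ℤ.*-identityʳ (+ n))) (ℤ.pos-* (ℕ.suc n) (ℕ.suc d-1))
    (ℤ.+<+ (ℕ.<-≤-trans (ℕ.n<1+n n) (ℕ.m≤m*n (ℕ.suc n) (ℕ.suc d-1)))))
  archimedean (mkℚ -[1+ n ] d-1 _) = 0 , ℚ.*<* ℤ.-<+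

  abstract

    -- Classical locatedness of `x`. Steps of a rational `δ` below `ε` cannot stay in the cut
    -- forever, by the Archimedean property, so one of them leads out of it.
    approximate : ∀ x {ε} → 0ℝ < ε →
                  ∃₂ λ l u → l < x × x < u × u < (l +ℝ ε)
    approximate x {ε} 0<ε = let δ , 0<δ , δ<ε = between {0ℝ} {ε} 0<ε
                                δ>0 = fromℚ<⇒∈ (fromℚ δ) {ℚ.0ℚ} 0<δ in go δ δ>0 (fromℚ<⇒∈ ε δ<ε)
      where
      module _ (δ : ℚ) (δ>0 : ℚ.0ℚ ℚ.< δ) (δ∈ : cut ε δ) where
        multiples∈ : (∀ p → cut x p → cut x (p ℚ.+ δ)) → ∀ {p} → cut x p →
                     ∀ n → cut x (p ℚ.+ natℚ n ℚ.* δ)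
        multiples∈ step {p} p∈ ℕ.zero    = subst (cut x)
          (sym (trans (cong (p ℚ.+_) (ℚ.*-zeroˡ δ)) (ℚ.+-identityʳ p))) p∈
        multiples∈ step {p} p∈ (ℕ.suc n) = subst (cut x)
          (trans (ℚ.+-assoc p (natℚ n ℚ.* δ) δ) (cong (p ℚ.+_) (sym
            (trans (cong (ℚ._* δ) (natℚ-suc n)) (trans (ℚ.*-distribʳ-+ δ (natℚ n) ℚ.1ℚ)
              (cong (natℚ n ℚ.* δ ℚ.+_) (ℚ.*-identityˡ δ)))))))
          (step _ (multiples∈ step p∈ n))

        exceeds : ∀ c → ∃ λ n → c ℚ.< natℚ n ℚ.* δ
        exceeds c = let n , lt = archimedean (c ℚ.* ℚ.1/ δ) in n ,
          subst (ℚ._< natℚ n ℚ.* δ)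
            (trans (ℚ.*-assoc c (ℚ.1/ δ) δ) (trans (cong (c ℚ.*_) (ℚ.*-inverseˡ δ)) (ℚ.*-identityʳ c)))
            (ℚ.*-monoˡ-<-pos δ lt)
          where instance
            δ-pos : ℚ.Positive δ
            δ-pos = ℚ.positive δ>0
            δ≢0 : ℚ.NonZero δ
            δ≢0 = ℚ.pos⇒nonZero δ

        jump : ∃ λ p → cut x p × ¬ cut x (p ℚ.+ δ)
        jump = dne λ ¬jump →
          let p , p∈ = inhabited x
              b , b∉ = bounded x
              n , lt = exceeds (b ℚ.- p)
              step = λ p p∈ → dne λ p+δ∉ → ¬jump (p , p∈ , p+δ∉)
          in ℚ.<-asym lt (move p (∈∉⇒< x (multiples∈ step p∈ n) b∉))
          where
          move : ∀ p {c b} → p ℚ.+ c ℚ.< b → c ℚ.< b ℚ.- p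
          move p {c} {b} lt = subst (ℚ._< b ℚ.- p)
            (trans (cong (ℚ._- p) (ℚ.+-comm p c)) (trans (ℚ.+-assoc c p (ℚ.- p))
              (trans (cong (c ℚ.+_) (ℚ.+-inverseʳ p)) (ℚ.+-identityʳ c))))
            (ℚ.+-monoˡ-< (ℚ.- p) lt)

        go : ∃₂ λ l u → l < x × x < u × u < (l +ℝ ε)
        go = let p , p∈ , p+δ∉ = jump
                 -- The endpoint `p + δ` might equal `x`; starting from a slightly larger `p′` in
                 -- the cut makes the upper inequality strict.
                 p′ , p<p′ , p′∈ = noMax x p∈
                 δ<p′-p+δ = ℚ.+-monoˡ-< δ p<p′
             in fromℚ p′ , fromℚ (p′ ℚ.+ δ) , ∈⇒fromℚ< x p′∈ ,
                ∉⇒<fromℚ x p+δ∉ δ<p′-p+δ , mk (_ , ℚ.<-irrefl refl ,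
                -- Membership in the cut of the sum asks for a summand strictly below `p′`; raising
                -- `δ` to `δ′` inside the cut of `ε` provides the slack.
                (let δ′ , δ<δ′ , δ′∈ = noMax ε δ∈ in
                 p′ ℚ.- (δ′ ℚ.- δ) , δ′ , p-r<p p′ (0<q-p δ<δ′) , δ′∈ , shuffle p′ δ′))
          where
          0<q-p : ∀ {p q} → p ℚ.< q → ℚ.0ℚ ℚ.< q ℚ.- p
          0<q-p {p} {q} p<q = subst (ℚ._< q ℚ.- p) (ℚ.+-inverseʳ p) (ℚ.+-monoˡ-< (ℚ.- p) p<q)
          p-r<p : ∀ p {r} → ℚ.0ℚ ℚ.< r → p ℚ.- r ℚ.< p
          p-r<p p {r} 0<r = subst (p ℚ.- r ℚ.<_) ([p-q]+q≡p p r) (p<p+ε (p ℚ.- r) 0<r)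
          shuffle : ∀ p δ′ → p ℚ.+ δ ≡ (p ℚ.- (δ′ ℚ.- δ)) ℚ.+ δ′
          shuffle p δ′ = solve 3 (λ p d d′ → p :+ d := (p :- (d′ :- d)) :+ d′) refl p δ δ′
            where
            open +-*-Solver

  -- Enumerations

  Enumerable : Set a → Set a
  Enumerable A = ∃ λ (e : ℕ → A) → ∀ x → ∃ λ k → e k ≡ x

  enumerable-map : {A : Set a} {B : Set b} (g : A → B) → (∀ y → ∃ λ x → g x ≡ y) →
                   Enumerable A → Enumerable B
  enumerable-map g surj (e , e-surj) = g ∘ e , λ y →
    let x , gx≡y = surj y; k , ek≡x = e-surj x in k , trans (cong g ek≡x) gx≡y

  -- Cantor's walk: from `(s , 0)` along the antidiagonal to `(0 , s)`, then on to `(s + 1 , 0)`.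
  next : ℕ × ℕ → ℕ × ℕ
  next (ℕ.zero  , n) = ℕ.suc n , 0
  next (ℕ.suc m , n) = m , ℕ.suc n

  unpair : ℕ → ℕ × ℕ
  unpair ℕ.zero    = 0 , 0
  unpair (ℕ.suc k) = next (unpair k)

  unpair-surjective : ∀ x → ∃ λ k → unpair k ≡ x
  unpair-surjective (m , n) = go n m
    where
    diagonal : ∀ s → (∃ λ k → unpair k ≡ (s , 0)) → ∀ n m → n ℕ.+ m ≡ s → ∃ λ k → unpair k ≡ (m , n)
    diagonal s start ℕ.zero    m refl = start
    diagonal s start (ℕ.suc n) m eq =
      let k , p = diagonal s start n (ℕ.suc m) (trans (ℕ.+-suc n m) eq) in ℕ.suc k , cong next p
    origin : ∀ s → ∃ λ k → unpair k ≡ (s , 0)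
    origin ℕ.zero    = 0 , refl
    origin (ℕ.suc s) = let k , p = diagonal s (origin s) s 0 (ℕ.+-identityʳ s) in ℕ.suc k , cong next p
    go : ∀ n m → ∃ λ k → unpair k ≡ (m , n)
    go n m = diagonal (n ℕ.+ m) (origin _) n m refl

  enumerable-× : {A : Set a} {B : Set b} → Enumerable A → Enumerable B → Enumerable (A × B)
  enumerable-× (e , e-surj) (e′ , e′-surj) = enumerable-map (λ (i , j) → e i , e′ j)
    (λ (x , y) → let i , p = e-surj x; j , q = e′-surj y in (i , j) , cong₂ _,_ p q)
    (unpair , unpair-surjective)

  enumerable-Vec : {A : Set a} → Enumerable A → ∀ n → Enumerable (Vec A n)
  enumerable-Vec A-enum ℕ.zero    = (λ _ → Vec.[]) , λ { Vec.[] → 0 , refl }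
  enumerable-Vec A-enum (ℕ.suc n) = enumerable-map (λ (x , xs) → x Vec.∷ xs)
    (λ { (x Vec.∷ xs) → (x , xs) , refl }) (enumerable-× A-enum (enumerable-Vec A-enum n))

  enumerable-ℤ : Enumerable ℤ
  enumerable-ℤ = enumerable-map (λ (m , n) → m ℤ.⊖ n)
    (λ { (+ n) → (n , 0) , refl ; -[1+ n ] → (0 , ℕ.suc n) , refl }) (unpair , unpair-surjective)

  enumerable-ℚ : Enumerable ℚ
  enumerable-ℚ = enumerable-map (λ (i , n) → i ℚ./ ℕ.suc n)
    (λ { q@(mkℚ i d-1 _) → (i , d-1) , ℚ.↥p/↧p≡p q }) (enumerable-× enumerable-ℤ (id , λ n → n , refl))

  -- Boolean combinations of closed definable sets

  _[_≔_] : Vector A N → Fin N → A → Vector A N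
  (v [ k ≔ x ]) i with i Fin.≟ k
  ... | yes _ = x
  ... | no _  = v i

  Inside : ℝ → ℝ → ℝ → Set
  Inside l u x = l < x × x < u

  Box : ℕ → (l u x : Vector ℝ N) → Set
  Box n l u x = ∀ i → toℕ i ℕ.< n → Inside (l i) (u i) (x i)

  Agree : ℕ → (x v : Vector ℝ N) → Set
  Agree n x v = ∀ i → n ℕ.≤ toℕ i → x i ≈ℝ v i

  -- The closure of the fibre of `X` through `v`: coordinates from `n` on are held fixed and act as
  -- parameters, the first `n` carry the box topology.
  Close : ℕ → Pred (Vector ℝ N) ℓ → Pred (Vector ℝ N) (lsuc 0ℓ ⊔ ℓ)
  Close n X v = ∀ l u → Box n l u v → ∃ λ x → X x × Box n l u x × Agree n x v

  -- Every fibre of X over the coordinates from n onwards is closed in ℝⁿ.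

  Closed : ℕ → Pred (Vector ℝ N) ℓ → Set (lsuc 0ℓ ⊔ ℓ)
  Closed n X = ∀ v → Close n X v → X v

  Agree-refl : ∀ (v : Vector ℝ N) → Agree n v v
  Agree-refl v i _ = ≈ℝ-refl {v i}

  Agree-trans : ∀ (x y z : Vector ℝ N) → Agree n x y → Agree n y z → Agree n x z
  Agree-trans x y z p q i n≤i = ≈ℝ-trans {x i} {y i} {z i} (p i n≤i) (q i n≤i)

  Agree-sym : ∀ (x y : Vector ℝ N) → Agree n x y → Agree n y x
  Agree-sym x y p i n≤i = ≈ℝ-sym {x i} {y i} (p i n≤i)

  Agree-weaken : ∀ {x v : Vector ℝ N} → Agree n x v → Agree (ℕ.suc n) x v
  Agree-weaken p i n<i = p i (ℕ.<⇒≤ n<i)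

  Inside-resp : ∀ {l l′ u u′ x x′} → l ≈ℝ l′ → u ≈ℝ u′ → x ≈ℝ x′ → Inside l u x → Inside l′ u′ x′
  Inside-resp {l} {l′} {u} {u′} {x} {x′} l≈ u≈ x≈ (l<x , x<u) =
    <-resp {l} {l′} {x} {x′} l≈ x≈ l<x , <-resp {x} {x′} {u} {u′} x≈ u≈ x<u

  Close-closed : (X : Pred (Vector ℝ N) ℓ) → Closed n (Close n X)
  Close-closed X v p l u v∈ =
    let x , x∈X , x∈ , x≈v = p l u v∈
        y , y∈X , y∈ , y≈x = x∈X l u x∈
    in y , y∈X , y∈ , Agree-trans y x v y≈x x≈v

  ⊆Close : (X : Pred (Vector ℝ N) ℓ) → ∀ {v} → X v → Close n X v
  ⊆Close X {v} v∈X l u v∈ = v , v∈X , v∈ , Agree-refl v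

  ≈ℝ-≡ : ∀ {x x′ y y′ : ℝ} → x ≡ x′ → y ≡ y′ → x ≈ℝ y → x′ ≈ℝ y′
  ≈ℝ-≡ refl refl x≈y = x≈y

  Agree-cong : {x v x′ v′ : Vector ℝ N} → (∀ i → x i ≡ x′ i) → (∀ i → v i ≡ v′ i) →
               Agree n x v → Agree n x′ v′
  Agree-cong x≡ v≡ p i n≤i = ≈ℝ-≡ (x≡ i) (v≡ i) (p i n≤i)

  Box-cong : {l u x l′ u′ x′ : Vector ℝ N} → (∀ i → l i ≡ l′ i) → (∀ i → u i ≡ u′ i) →
             (∀ i → x i ≡ x′ i) →
             Box n l u x → Box n l′ u′ x′
  Box-cong l≡ u≡ x≡ p i i<n rewrite sym (l≡ i) | sym (u≡ i) | sym (x≡ i) = p i i<n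

  box-around : ∀ (v : Vector ℝ N) → ∃₂ λ (l u : Vector ℝ N) → ∀ i → Inside (l i) (u i) (v i)
  box-around v = fromℚ ∘ proj₁ ∘ below ∘ v , fromℚ ∘ proj₁ ∘ above ∘ v ,
    λ i → proj₂ (below (v i)) , proj₂ (above (v i))

  module _ (k : Fin N) where

    index-cases : ∀ i → toℕ i ℕ.< ℕ.suc (toℕ k) → toℕ i ℕ.< toℕ k ⊎ i ≡ k
    index-cases i (ℕ.s≤s i≤k) with ℕ.m≤n⇒m<n∨m≡n i≤k
    ... | inj₁ i<k = inj₁ i<k
    ... | inj₂ i≡k = inj₂ (Fin.toℕ-injective i≡k)

    Agree-extend : ∀ (x v : Vector ℝ N) → x k ≈ℝ v k → Agree (ℕ.suc (toℕ k)) x v → Agree (toℕ k) x v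
    Agree-extend x v xk≈vk x≈v i k≤i with ℕ.m≤n⇒m<n∨m≡n k≤i
    ... | inj₁ k<i = x≈v i k<i
    ... | inj₂ k≡i with refl ← Fin.toℕ-injective k≡i = xk≈vk

    module _ {l u x : Vector ℝ N} {l′ u′ : ℝ} where

      Box-extend : Inside l′ u′ (x k) → Box (toℕ k) l u x →
                   Box (ℕ.suc (toℕ k)) (l [ k ≔ l′ ]) (u [ k ≔ u′ ]) x
      Box-extend xk∈ x∈ i i≤k with i Fin.≟ k | index-cases i i≤k
      ... | yes refl | _        = xk∈
      ... | no _     | inj₁ i<k = x∈ i i<k
      ... | no i≢k   | inj₂ i≡k = ⊥-elim (i≢k i≡k)

      Box-restrict : Box (ℕ.suc (toℕ k)) (l [ k ≔ l′ ]) (u [ k ≔ u′ ]) x →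
                     Inside l′ u′ (x k) × Box (toℕ k) l u x
      Box-restrict p = here-k , λ i i<k → there-k i i<k
        where
        here-k : Inside l′ u′ (x k)
        here-k with k Fin.≟ k | p k (ℕ.n<1+n _)
        ... | yes _  | q = q
        ... | no k≢k | _ = ⊥-elim (k≢k refl)
        there-k : ∀ i → toℕ i ℕ.< toℕ k → Inside (l i) (u i) (x i)
        there-k i i<k with i Fin.≟ k | p i (ℕ.m≤n⇒m≤1+n i<k)
        ... | yes refl | _ = ⊥-elim (ℕ.<-irrefl refl i<k)
        ... | no _     | q = q

  abstract

    shrink : ∀ {l u} → l < u → ∃₂ λ l′ u′ → l < l′ × l′ < u′ × u′ < u
    shrink l<u =
      let m , l<m , m<u = between l<u
          l′ , l<l′ , l′<m = between l<m
          u′ , m<u′ , u′<u = between m<u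
      in fromℚ l′ , fromℚ u′ , l<l′ , <-trans l′<m m<u′ , u′<u

  module _ {L : Language f r} (_≺_ : Language.RelSym L 2) where

    less′ : Term L A n → Term L A n → Formula L A n
    less′ t u = rel′ _≺_ (t ∷ u ∷ [])

    abstract

      less-holds : {D : Setoid c e} {M : Structure L D s} {nm : A → ∣ D ∣}
                   {t u : Term L A n} {v : Vector ∣ D ∣ n} →
                   Holds M nm v (less′ t u) ⇔ Structure.rel M _≺_ (value M nm t v ∷ value M nm u v ∷ [])
      less-holds {D = D} {M = M} = mk⇔
        (λ (sat (lift p)) → Structure.rel-resp M _≺_ (λ { zero → D.refl ; (suc zero) → D.refl }) p)
        (λ p → sat (lift (Structure.rel-resp M _≺_ (λ { zero → D.refl ; (suc zero) → D.refl }) p)))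
        where module D = Setoid D

  -- First-order definability of closures

  module Constructibility {L : Language f r} (𝓡 : Structure L ℝ-setoid s) (E : Expansion ℝ<+ 𝓡) where

    _⋖_ : ℝ → ℝ → Set s
    _⋖_ = order E 𝓡

    ⋖⇔< : ∀ {x y} → x ⋖ y ⇔ x < y
    ⋖⇔< {x} {y} = mk⇔ (mk ∘ to same) (from same ∘ get)
      where same = Expansion.rel-same E less (x ∷ y ∷ [])

    infix 6 _<′_
    _<′_ : Term L A n → Term L A n → Formula L A n
    _<′_ = less′ (Expansion.relMap E less)

    inside′ : (l u x : Term L A n) → Formula L A n
    inside′ l u x = l <′ x ∧′ x <′ u

    box′ : ℕ → (l u x : Fin N → Term L A m) → Formula L A m
    box′ n l u x = ⋀ λ i → guard (toℕ i ℕ.<? n) (inside′ (l i) (u i) (x i))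

    agree′ : ℕ → (x v : Fin N → Term L A m) → Formula L A m
    agree′ n x v = ⋀ λ i → guard (n ℕ.≤? toℕ i) (x i ≈′ v i)

    module _ (nm : A → ℝ) where

      ⟦_⟧ : (Fin N → Term L A m) → Vector ℝ m → Vector ℝ N
      ⟦ t ⟧ v i = value 𝓡 nm (t i) v

      abstract

        <-holds : {t u : Term L A n} {v : Vector ℝ n} →
                  Holds 𝓡 nm v (t <′ u) ⇔ value 𝓡 nm t v < value 𝓡 nm u v
        <-holds = mk⇔ (to ⋖⇔< ∘ to (less-holds _)) (from (less-holds _) ∘ from ⋖⇔<)

        inside-holds : {l u x : Term L A n} {v : Vector ℝ n} →
                       Holds 𝓡 nm v (inside′ l u x) ⇔
                       Inside (value 𝓡 nm l v) (value 𝓡 nm u v) (value 𝓡 nm x v)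
        inside-holds = mk⇔
          (λ p → let p , q = to ∧-holds p in to <-holds p , to <-holds q)
          (λ (p , q) → from ∧-holds (from <-holds p , from <-holds q))

        box-holds : {l u x : Fin N → Term L A m} {v : Vector ℝ m} →
                    Holds 𝓡 nm v (box′ n l u x) ⇔ Box n (⟦ l ⟧ v) (⟦ u ⟧ v) (⟦ x ⟧ v)
        box-holds {n = n} = mk⇔
          (λ p i i<n → to inside-holds (to (guard-holds (toℕ i ℕ.<? n)) (to ⋀-holds p i) i<n))
          (λ p → from ⋀-holds λ i → from (guard-holds (toℕ i ℕ.<? n)) λ i<n →
            from inside-holds (p i i<n))

        agree-holds : {x y : Fin N → Term L A m} {v : Vector ℝ m} →
                      Holds 𝓡 nm v (agree′ n x y) ⇔ Agree n (⟦ x ⟧ v) (⟦ y ⟧ v)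
        agree-holds {n = n} = mk⇔
          (λ p i n≤i → to ≈-holds (to (guard-holds (n ℕ.≤? toℕ i)) (to ⋀-holds p i) n≤i))
          (λ p → from ⋀-holds λ i → from (guard-holds (n ℕ.≤? toℕ i)) λ n≤i → from ≈-holds (p i n≤i))

    Set⟦_⟧ : Formula L ⊥ n → Pred (Vector ℝ n) _
    Set⟦ φ ⟧ v = Holds 𝓡 (λ ()) v φ

    ≡⇒≈ : ∀ {x y : ℝ} → x ≡ y → x ≈ℝ y
    ≡⇒≈ = Setoid.reflexive ℝ-setoid

    module _ (n : ℕ) {N : ℕ} (φ : Formula L ⊥ N) where
      private
        x′ u′ l′ v′ : Fin N → Term L ⊥ (N ℕ.+ (N ℕ.+ (N ℕ.+ N)))
        x′ i = var (i ↑ˡ _)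
        u′ i = var (N ↑ʳ (i ↑ˡ _))
        l′ i = var (N ↑ʳ (N ↑ʳ (i ↑ˡ N)))
        v′ i = var (N ↑ʳ (N ↑ʳ (N ↑ʳ i)))

      -- Open boxes are parametrised by their corners, so closure is first order. In the innermost
      -- scope the variables come in the blocks `x`, `u`, `l`, `v`.
      close′ : Formula L ⊥ N
      close′ = ¬′ ∃ⁿ N (∃ⁿ N
        (box′ n (λ i → var (N ↑ʳ (i ↑ˡ N))) (λ i → var (i ↑ˡ _)) (λ i → var (N ↑ʳ (N ↑ʳ i))) ∧′
         ¬′ ∃ⁿ N (sub (λ ()) x′ φ ∧′ box′ n l′ u′ x′ ∧′ agree′ n x′ v′)))

      abstract

        close-holds : ∀ {v} → Set⟦ close′ ⟧ v ⇔ Close n Set⟦ φ ⟧ v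
        close-holds {v} = mk⇔
          (λ p l u v∈ → dne λ ¬∃ → to ¬-holds p (from (∃ⁿ-holds N) (l , from (∃ⁿ-holds N) (u ,
            from ∧-holds
              ( from (box-holds _) (Box-cong (λ i → sym (l≡ l u i)) (λ i → sym (u≡ l u i))
                  (λ i → sym (v≡ l u i)) v∈)
              , from ¬-holds λ q → ¬∃
                (let x , q = to (∃ⁿ-holds N) q
                     x∈X , q = to ∧-holds q
                     x∈ , x≈v = to ∧-holds q
                     x≡ = λ i → lookup-++ˡ x (u ++ (l ++ v)) i
                     ʳ≡ = λ i → lookup-++ʳ x (u ++ (l ++ v)) i
                 in x , to (rename-holds (λ i → ≡⇒≈ (x≡ i))) x∈X
                      , Box-cong (λ i → trans (ʳ≡ _) (l≡ l u i)) (λ i → trans (ʳ≡ _) (u≡ l u i))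
                          x≡ (to (box-holds _) x∈)
                      , λ i n≤i → Agree-cong x≡ (λ i → trans (ʳ≡ _) (v≡ l u i))
                          (to (agree-holds _) x≈v) i n≤i))))))
          (λ p → from ¬-holds λ q →
            let l , q = to (∃ⁿ-holds N) q
                u , q = to (∃ⁿ-holds N) q
                v∈ , q = to ∧-holds q
                x , x∈X , x∈ , x≈v = p l u (Box-cong (l≡ l u) (u≡ l u) (v≡ l u) (to (box-holds _) v∈))
                x≡ = λ i → lookup-++ˡ x (u ++ (l ++ v)) i
                ʳ≡ = λ i → lookup-++ʳ x (u ++ (l ++ v)) i
            in to ¬-holds q (from (∃ⁿ-holds N) (x , from ∧-holds
              ( from (rename-holds (λ i → ≡⇒≈ (x≡ i))) x∈X
              , from ∧-holds
              ( from (box-holds _) (Box-cong (λ i → sym (trans (ʳ≡ _) (l≡ l u i)))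
                                             (λ i → sym (trans (ʳ≡ _) (u≡ l u i))) (λ i → sym (x≡ i)) x∈)
              , from (agree-holds _) (Agree-cong (λ i → sym (x≡ i))
                  (λ i → sym (trans (ʳ≡ _) (v≡ l u i))) x≈v))))))
          where
          module _ (l u : Vector ℝ N) where
            u≡ : ∀ i → (u ++ (l ++ v)) (i ↑ˡ _) ≡ u i
            u≡ = lookup-++ˡ u (l ++ v)
            l≡ : ∀ i → (u ++ (l ++ v)) (N ↑ʳ (i ↑ˡ N)) ≡ l i
            l≡ i = trans (lookup-++ʳ u (l ++ v) _) (lookup-++ˡ l v i)
            v≡ : ∀ i → (u ++ (l ++ v)) (N ↑ʳ (N ↑ʳ i)) ≡ v i
            v≡ i = trans (lookup-++ʳ u (l ++ v) _) (lookup-++ʳ l v i)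

    -- O-minimality on the line

    private module ± = Extrema _⋖_

    Covered : List (Piece ℝ) → ℝ → Set _
    Covered ps x = Any (λ p → InPiece ℝ-setoid _⋖_ p x) ps

    open-below : ∀ {e y} → e ±.<± [ y ] → ∃ λ l → l < y × (∀ {x} → l < x → e ±.<± [ x ])
    open-below (±.⊥±<[ y ]) = let l , l<y = below y in fromℚ l , l<y , λ {x} _ → ±.⊥±<[ x ]
    open-below (±.[ e<y ]) = _ , to ⋖⇔< e<y , λ e<x → ±.[ from ⋖⇔< e<x ]

    open-above : ∀ {e y} → [ y ] ±.<± e → ∃ λ u → y < u × (∀ {x} → x < u → [ x ] ±.<± e)
    open-above (±.[ y<e ]) = _ , to ⋖⇔< y<e , λ x<e → ±.[ from ⋖⇔< x<e ]
    open-above (±.[ y ]<⊤±) = let u , y<u = above y in fromℚ u , y<u , λ {x} _ → ±.[ x ]<⊤±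

    -- If the pieces cover no interval within `(p , q)`, they cover only finitely many points there,
    -- and a small neighbourhood of `y` avoids those other than `y`. Induction on the list narrows
    -- the neighbourhood piece by piece.
    isolate : ∀ ps {p q y} → Inside p q y →
              (∀ l u → l < u → ¬ (∀ x → Inside l u x → Inside p q x × Covered ps x)) →
              ∃₂ λ l u → Inside l u y × (∀ {x} → Inside l u x → Inside p q x × (Covered ps x → x ≈ℝ y))
    isolate List.[] {p} {q} y∈ thin = p , q , y∈ , λ x∈ → x∈ , λ ()
    isolate (piece List.∷ ps) {p} {q} {y} y∈ thin
      with isolate ps y∈ (λ l u l<u ⊆ → thin l u l<u λ x x∈ → proj₁ (⊆ x x∈) , there (proj₂ (⊆ x x∈)))
    ... | l , u , (l<y , y<u) , small with piece
    ...   | interval (i , j) = l , u , (l<y , y<u) , λ {x} x∈ → proj₁ (small x∈) , λ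
      { (here (lift (i<x , x<j))) → ⊥-elim
          -- An interval piece that meets the neighbourhood in `x` covers a whole interval around
          -- `x`, against `thin`.
          (let l′ , l′<x , >l′ = open-below i<x
               u′ , x<u′ , <u′ = open-above x<j
               l″ , l″<x , >l″ = maximum-below (proj₁ x∈) l′<x
               u″ , x<u″ , <u″ = minimum-above (proj₂ x∈) x<u′
           in thin l″ u″ (<-trans l″<x x<u″) λ z (l″<z , z<u″) →
                proj₁ (small (proj₁ (>l″ l″<z) , proj₁ (<u″ z<u″))) ,
                here (lift (>l′ (proj₂ (>l″ l″<z)) , <u′ (proj₂ (<u″ z<u″)))))
      ; (there x∈ps) → proj₂ (small x∈) x∈ps }
    ...   | point z with <-cmp z y
    ...     | inj₂ (inj₁ z≈y) = l , u , (l<y , y<u) , λ {x} x∈ → proj₁ (small x∈) , λ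
      { (here (lift x≈z)) → ≈ℝ-trans {x} {z} {y} x≈z z≈y
      ; (there x∈ps) → proj₂ (small x∈) x∈ps }
    ...     | inj₁ z<y = let l′ , l′<y , >l′ = maximum-below l<y z<y in
      l′ , u , (l′<y , y<u) , λ {x} (l′<x , x<u) →
        let x∈ = proj₁ (>l′ l′<x) , x<u in proj₁ (small x∈) , λ
          { (here (lift x≈z)) → ⊥-elim (<-irrefl (≈ℝ-sym {x} {z} x≈z) (proj₂ (>l′ l′<x)))
          ; (there x∈ps) → proj₂ (small x∈) x∈ps }
    ...     | inj₂ (inj₂ y<z) = let u′ , y<u′ , <u′ = minimum-above y<u y<z in
      l , u′ , (l<y , y<u′) , λ {x} (l<x , x<u′) →
        let x∈ = l<x , proj₁ (<u′ x<u′) in proj₁ (small x∈) , λ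
          { (here (lift x≈z)) → ⊥-elim (<-irrefl x≈z (proj₂ (<u′ x<u′)))
          ; (there x∈ps) → proj₂ (small x∈) x∈ps }

    Decided : (ℝ → Set ℓ) → ℝ → ℝ → Set (lsuc 0ℓ ⊔ ℓ)
    Decided X l u = (∀ {x} → Inside l u x → X x) ⊎ (∀ {x} → Inside l u x → ¬ X x)

    Tame : (ℝ → Set ℓ) → Set (lsuc 0ℓ ⊔ s ⊔ ℓ)
    Tame X = ∃ λ ps → ∀ x → X x ⇔ Covered ps x

    -- If no interval within `(p , q)` is covered, the set is discrete there, so some interval
    -- misses it.
    decide : (X : ℝ → Set ℓ) → Tame X → ∀ {p q} → p < q →
             ∃₂ λ l u → l < u × p < l × u < q × Decided X l u
    decide X (ps , X⇔) {p} {q} p<q =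
      -- Both endpoints must move strictly for `nested-intervals`.
      let l , u , l<u , ⊆ , d = coarse
          l′ , u′ , l<l′ , l′<u′ , u′<u = shrink l<u
      in l′ , u′ , l′<u′ , proj₁ (⊆ (l<l′ , <-trans l′<u′ u′<u)) ,
         proj₂ (⊆ (<-trans l<l′ l′<u′ , u′<u)) ,
         restrict d l<l′ u′<u
      where
      restrict : ∀ {l u l′ u′} → Decided X l u → l < l′ → u′ < u → Decided X l′ u′
      restrict (inj₁ all)  l<l′ u′<u = inj₁ λ (l′<x , x<u′) →
        all (<-trans l<l′ l′<x , <-trans x<u′ u′<u)
      restrict (inj₂ none) l<l′ u′<u = inj₂ λ (l′<x , x<u′) →
        none (<-trans l<l′ l′<x , <-trans x<u′ u′<u)
      coarse : ∃₂ λ l u → l < u × (∀ {x} → Inside l u x → Inside p q x) × Decided X l u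
      coarse with em _ {∃₂ λ l u → l < u × (∀ x → Inside l u x → Inside p q x × Covered ps x)}
      ... | yes (l , u , l<u , ⊆) = l , u , l<u , (λ x∈ → proj₁ (⊆ _ x∈)) ,
        inj₁ (λ x∈ → from (X⇔ _) (proj₂ (⊆ _ x∈)))
      ... | no thin =
        let y , p<y , y<q = between p<q
            l , u , (l<y , y<u) , small = isolate ps (p<y , y<q) (λ l u l<u ⊆ → thin (l , u , l<u , ⊆))
        -- The point `y` may itself belong to `X`; the interval to its right leaves it out.
        in fromℚ y , u , y<u , (λ (y<x , x<u) → proj₁ (small (<-trans l<y y<x , x<u))) ,
           inj₂ λ {x} (y<x , x<u) x∈X →
             <-irrefl (≈ℝ-sym {x} {fromℚ y} (proj₂ (small (<-trans l<y y<x , x<u)) (to (X⇔ x) x∈X))) y<x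

    -- The Baire category argument.

    decide-all : (X : ℕ → ℝ → Set ℓ) → (∀ k → Tame (X k)) → ∀ {p q} → p < q →
                 ∃ λ y → Inside p q y × (∀ k → ∃₂ λ l u → Inside l u y × Decided (X k) l u)
    decide-all X X-tame {p} {q} p<q =
      let y , y∈ = nested-intervals l u l< u< l<u in
      -- The interval with index `k + 1` is the one on which `X k` was decided.
      y , y∈ 0 , λ k → l (ℕ.suc k) , u (ℕ.suc k) , y∈ (ℕ.suc k) ,
      proj₂ (proj₂ (proj₂ (proj₂ (proj₂ (stage k)))))
      where
      I : ℕ → ∃₂ λ l u → l < u
      stage : ∀ k → _
      stage k = decide (X k) (X-tame k) (proj₂ (proj₂ (I k)))
      I ℕ.zero    = p , q , p<q
      I (ℕ.suc k) = let l , u , l<u , _ = stage k in l , u , l<u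
      l u : ℕ → ℝ
      l k = proj₁ (I k)
      u k = proj₁ (proj₂ (I k))
      l<u : ∀ k → l k < u k
      l<u k = proj₂ (proj₂ (I k))
      l< : ∀ k → l k < l (ℕ.suc k)
      l< k = let _ , _ , _ , p<l , _ = stage k in p<l
      u< : ∀ k → u (ℕ.suc k) < u k
      u< k = let _ , _ , _ , _ , u<q , _ = stage k in u<q

  -- The induction step: one more coordinate

  module Step {L : Language f r} (𝓡 : Structure L ℝ-setoid s) (E : Expansion ℝ<+ 𝓡)
              (omin : OMinimal 𝓡 (order E 𝓡)) where
    open Constructibility 𝓡 E

    module _ (k : Fin N) (v : Vector ℝ N) where

      -- The projection to axis `k` of the section of `ζ` determined by the coordinates of `v`
      -- beyond `k`; the coordinates below `k` are projected away.
      Fibre : Formula L ℝ N → ℝ → Set _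
      Fibre ζ y = ∃ λ w → Holds 𝓡 id w ζ × w k ≈ℝ y × Agree (ℕ.suc (toℕ k)) w v

      fibre′ : Formula L ℝ N → Formula L ℝ 1
      fibre′ ζ = ∃ⁿ N (sub id (λ i → var (i ↑ˡ 1)) ζ ∧′ var (k ↑ˡ 1) ≈′ var (N ↑ʳ zero) ∧′
        agree′ (ℕ.suc (toℕ k)) (λ i → var (i ↑ˡ 1)) (par ∘ v))

      fibre-holds : ∀ {ζ y} → Holds 𝓡 id (y ∷ []) (fibre′ ζ) ⇔ Fibre ζ y
      fibre-holds {ζ} {y} = mk⇔
        (λ p → let w , p = to (∃ⁿ-holds N) p
                   w∈ , p = to ∧-holds p
                   wk≈ , w≈v = to ∧-holds p
                   w≡ = lookup-++ˡ w (y ∷ [])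
                   y≡ = lookup-++ʳ w (y ∷ []) zero
               in w , Holds-cong (λ i → ≡⇒≈ (w≡ i)) (to (sub-holds 𝓡 id id id (λ x → ≈ℝ-refl {x})) w∈) ,
                  ≈ℝ-≡ (w≡ k) y≡ (to ≈-holds wk≈) ,
                  λ i i>k → ≈ℝ-≡ {y = v i} (w≡ i) refl (to (agree-holds id) w≈v i i>k))
        (λ (w , w∈ , wk≈ , w≈v) →
          let w≡ = lookup-++ˡ w (y ∷ [])
              y≡ = lookup-++ʳ w (y ∷ []) zero
          in from (∃ⁿ-holds N) (w , from ∧-holds
            ( from (sub-holds 𝓡 id id id (λ x → ≈ℝ-refl {x})) (Holds-cong (λ i → ≡⇒≈ (sym (w≡ i))) w∈)
            , from ∧-holds
            ( from ≈-holds (≈ℝ-≡ (sym (w≡ k)) (sym y≡) wk≈)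
            , from (agree-holds id) (λ i i>k → ≈ℝ-≡ {y = v i} (sym (w≡ i)) refl (w≈v i i>k))))))

      fibre-tame : ∀ ζ → Tame (Fibre ζ)
      fibre-tame ζ = let ps , p = omin (fibre′ ζ) in
        ps , λ y → mk⇔ (λ q → to (p y) (unsat (from fibre-holds q)))
                    (λ q → to fibre-holds (sat (from (p y) q)))

    constants : Formula L ⊥ N → Formula L ℝ N
    constants = sub (λ ()) var

    constants-holds : {φ : Formula L ⊥ N} {v : Vector ℝ N} → Holds 𝓡 id v (constants φ) ⇔ Set⟦ φ ⟧ v
    constants-holds {v = v} = rename-holds (λ i → ≈ℝ-refl {v i})

    -- Boxes are coded by `Vec` instead of functions from `Fin N`, since they are enumerated up to
    -- `_≡_`.
    lo hi : Vec (ℚ × ℚ) N → Vector ℝ N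
    lo B i = fromℚ (proj₁ (Vec.lookup B i))
    hi B i = fromℚ (proj₂ (Vec.lookup B i))

    Refines : ℕ → (l u w : Vector ℝ N) → Vec (ℚ × ℚ) N → Set₁
    Refines n l u w B = Box n (lo B) (hi B) w × (∀ {x} → Box n (lo B) (hi B) x → Box n l u x)

    -- Density of the rationals lets countably many boxes replace all boxes, as the category
    -- argument demands.
    rational-box : ∀ n {l u w : Vector ℝ N} → Box n l u w → ∃ (Refines n l u w)
    rational-box {N = N} n {l} {u} {w} w∈ = Vec.tabulate (proj₁ ∘ side) ,
      (λ i i<n → proj₁ (good i i<n)) , λ x∈ i i<n → proj₂ (good i i<n) (x∈ i i<n)
      where
      Good : Fin N → ℚ × ℚ → Set₁
      Good i (a , b) = toℕ i ℕ.< n → Inside (fromℚ a) (fromℚ b) (w i) ×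
                       (∀ {y} → Inside (fromℚ a) (fromℚ b) y → Inside (l i) (u i) y)
      side : ∀ i → ∃ (Good i)
      side i with toℕ i ℕ.<? n
      -- A default pair: the sides from `n` on are never tested.
      ... | no i≮n = (ℚ.0ℚ , ℚ.0ℚ) , λ i<n → ⊥-elim (i≮n i<n)
      ... | yes i<n = let a , l<a , a<w = between (proj₁ (w∈ i i<n))
                          b , w<b , b<u = between (proj₂ (w∈ i i<n))
                      in (a , b) , λ _ → (a<w , w<b) , λ (a<y , y<b) → <-trans l<a a<y , <-trans y<b b<u
      good : ∀ i → Good i (Vec.lookup (Vec.tabulate (proj₁ ∘ side)) i)
      good i = subst (Good i) (sym (Vec.lookup∘tabulate (proj₁ ∘ side) i)) (proj₂ (side i))

    module _ (k : Fin N) (φ : Formula L ⊥ N) (φ-closed : Closed (toℕ k) Set⟦ φ ⟧) where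
      private
        -- In the notation of the opening outline, `φ` is F, `γ` is G, `bad` is G without F, and `π`
        -- further down is P.
        γ : Formula L ⊥ N
        γ = close′ (ℕ.suc (toℕ k)) φ

        bad : Formula L ℝ N
        bad = constants (γ ∧′ ¬′ φ)

        codes : Enumerable (Vec (ℚ × ℚ) N)
        codes = enumerable-Vec (enumerable-× enumerable-ℚ enumerable-ℚ) N

        slab : Vec (ℚ × ℚ) N → Formula L ℝ N
        slab B = constants φ ∧′ box′ (toℕ k) (par ∘ lo B) (par ∘ hi B) var

      -- If y is in the fibre of bad, as witnessed by w, then F := Set⟦ φ ⟧ misses B × {y} for a
      -- box B around w but meets B × J for all intervals J around y, so y is in the frontier of
      -- {y | F meets B × {y}}.  Rational boxes B suffice.

      bad-thin : ∀ v {p q} → p < q → ¬ (∀ y → Inside p q y → Fibre k v bad y)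
      bad-thin v p<q ⊆bad =
        -- The category argument yields a `y` near which each slab fibre is decided: it contains, or
        -- misses, an interval around `y`.
        let y , y∈ , decided = decide-all (λ j → Fibre k v (slab (proj₁ codes j)))
                                              (λ j → fibre-tame k v (slab (proj₁ codes j))) p<q
            w , w∈bad , wk≈y , w≈v = ⊆bad y y∈
            w∈γ , w∉φ = to ∧-holds (to constants-holds w∈bad)
        -- Closedness of `φ` in the first `k` coordinates puts `w` in `φ`, once every box around `w`
        -- meets `φ` in the fibre of `w`.
        in to ¬-holds w∉φ (φ-closed w λ l u w∈ →
          let B , B-refines = rational-box (toℕ k) w∈
              j , j≡B = proj₂ codes B
              w∈j , j⊆ = subst (Refines (toℕ k) l u w) (sym j≡B) B-refines
              x , x∈φ , x∈j , x≈w = meets (proj₁ codes j) (decided j) w∈j w∈γ wk≈y w≈v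
          in x , x∈φ , j⊆ x∈j , x≈w)
        where
        meets : ∀ B {w y} → (∃₂ λ l u → Inside l u y × Decided (Fibre k v (slab B)) l u) →
                Box (toℕ k) (lo B) (hi B) w → Set⟦ γ ⟧ w → w k ≈ℝ y → Agree (ℕ.suc (toℕ k)) w v →
                ∃ λ x → Set⟦ φ ⟧ x × Box (toℕ k) (lo B) (hi B) x × Agree (toℕ k) x w
        -- The fibre of the slab contains `y` itself, which gives a point of `φ` in the box with the
        -- same coordinates as `w` from `k` on.
        meets B {w} {y} (_ , _ , y∈ , inj₁ all) w∈ w∈γ wk≈y w≈v =
          let x , x∈slab , xk≈y , x≈v = all y∈
              x∈φ , x∈B = to ∧-holds x∈slab
          in x , to constants-holds x∈φ , to (box-holds id) x∈B ,
             Agree-extend k x w (≈ℝ-trans {x k} {y} {w k} xk≈y (≈ℝ-sym {w k} {y} wk≈y))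
               (Agree-trans x v w x≈v (Agree-sym w v w≈v))
        -- Extended by `(l , u)` in direction `k`, the box is a neighbourhood of a point of the
        -- closure `γ` and meets `φ`, so the fibre cannot miss `(l , u)`.
        meets B {w} {y} (l , u , y∈ , inj₂ none) w∈ w∈γ wk≈y w≈v =
          let wk∈ = Inside-resp {l} {l} {u} {u} {y} {w k}
                      (≈ℝ-refl {l}) (≈ℝ-refl {u}) (≈ℝ-sym {w k} {y} wk≈y) y∈
              x , x∈φ , x∈ , x≈w = to (close-holds _ φ) w∈γ _ _ (Box-extend k wk∈ w∈)
              xk∈ , x∈B = Box-restrict k x∈
          in ⊥-elim (none xk∈ (x , from ∧-holds (from constants-holds x∈φ , from (box-holds id) x∈B) ,
               ≈ℝ-refl {x k} , Agree-trans x w v x≈w w≈v))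

      private
        π : Formula L ⊥ N
        π = ∃ⁿ N (sub (λ ()) (λ i → var (i ↑ˡ N)) (γ ∧′ ¬′ φ) ∧′
                  agree′ (toℕ k) (λ i → var (i ↑ˡ N)) (λ i → var (N ↑ʳ i)))

      π-holds : ∀ {v} → Set⟦ π ⟧ v ⇔ ∃ λ w → Set⟦ γ ∧′ ¬′ φ ⟧ w × Agree (toℕ k) w v
      π-holds {v} = mk⇔
        (λ p → let w , p = to (∃ⁿ-holds N) p
                   w∈ , w≈v = to ∧-holds p
               in w , to (rename-holds (λ i → ≡⇒≈ (lookup-++ˡ w v i))) w∈ ,
                  Agree-cong (lookup-++ˡ w v) (lookup-++ʳ w v) (to (agree-holds _) w≈v))
        (λ (w , w∈ , w≈v) → from (∃ⁿ-holds N) (w , from ∧-holds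
          ( from (rename-holds (λ i → ≡⇒≈ (lookup-++ˡ w v i))) w∈
          , from (agree-holds _) (Agree-cong (sym ∘ lookup-++ˡ w v) (sym ∘ lookup-++ʳ w v) w≈v))))

      -- Finiteness of P in direction `k`, in local form: the fibre of `bad` is a finite union of
      -- pieces that covers no interval, so near `v k` it has no point except possibly `v k`.
      π-isolated : ∀ v → ∃₂ λ l u → Inside l u (v k) ×
                   (∀ {x} → Set⟦ π ⟧ x → Inside l u (x k) → Agree (ℕ.suc (toℕ k)) x v → Agree (toℕ k) x v)
      π-isolated v =
        let ps , ps⇔ = fibre-tame k v bad
            p , p<vk = below (v k)
            q , vk<q = above (v k)
            l , u , vk∈ , small = isolate ps (p<vk , vk<q) λ l u l<u ⊆ →
              bad-thin v l<u λ y y∈ → from (ps⇔ y) (proj₂ (⊆ y y∈))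
        in l , u , vk∈ , λ {x} x∈π xk∈ x≈v →
          let w , w∈ , w≈x = to π-holds x∈π
          in Agree-extend k x v (proj₂ (small xk∈) (to (ps⇔ (x k))
               (w , from constants-holds w∈ , w≈x k ℕ.≤-refl ,
                Agree-trans w x v (Agree-weaken {x = w} {v = x} w≈x) x≈v))) x≈v

      -- Within the fibre, a box thin enough in direction `k` meets P only where coordinate `k`
      -- equals `v k`, so approximation in `k + 1` coordinates becomes approximation in the first
      -- `k`.
      π-near : ∀ {X : Pred (Vector ℝ N) ℓ} {v} → (∀ {x} → X x → Set⟦ π ⟧ x) →
               Close (ℕ.suc (toℕ k)) X v → Close (toℕ k) X v
      π-near {v = v} X⊆π v∈ l u v∈B =
        let l′ , u′ , vk∈ , isolated = π-isolated v
            x , x∈X , x∈ , x≈v = v∈ _ _ (Box-extend k vk∈ v∈B)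
            xk∈ , x∈B = Box-restrict k x∈
        in x , x∈X , x∈B , isolated (X⊆π x∈X) xk∈ x≈v

      π-resp : ∀ {x v} → Agree (toℕ k) x v → Set⟦ π ⟧ x → Set⟦ π ⟧ v
      π-resp {x} {v} x≈v x∈π = let w , w∈ , w≈x = to π-holds x∈π in
        from π-holds (w , w∈ , Agree-trans w x v w≈x x≈v)

      -- P ignores the coordinates below `k`, so a single point of it in any box around `v`
      -- suffices.
      near⇒π : ∀ {v} → Close (toℕ k) Set⟦ π ⟧ v → Set⟦ π ⟧ v
      near⇒π {v} v∈ = let l , u , v∈B = box-around v
                          x , x∈π , _ , x≈v = v∈ l u (λ i _ → v∈B i) in π-resp x≈v x∈π

      closure-closed : Closed (ℕ.suc (toℕ k)) Set⟦ γ ⟧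
      closure-closed v v∈ = from (close-holds _ φ) (Close-closed Set⟦ φ ⟧ v λ l u v∈B →
        let x , x∈γ , p = v∈ l u v∈B in x , to (close-holds _ φ) x∈γ , p)

      π-closed : Closed (ℕ.suc (toℕ k)) Set⟦ π ⟧
      π-closed v v∈ = near⇒π (π-near id v∈)

      φ∧π-closed : Closed (ℕ.suc (toℕ k)) Set⟦ φ ∧′ π ⟧
      φ∧π-closed v v∈ =
        let v∈′ = π-near (proj₂ ∘ to ∧-holds) v∈ in
        from ∧-holds
          ( φ-closed v (λ l u v∈B → let x , x∈ , p = v∈′ l u v∈B in x , proj₁ (to ∧-holds x∈) , p)
          , near⇒π (λ l u v∈B → let x , x∈ , p = v∈′ l u v∈B in x , proj₂ (to ∧-holds x∈) , p))

      -- The formula is (G without P) ∪ (F ∩ P), because F is part of G. A point of G outside F lies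
      -- in P, so outside P the sets F and G coincide.
      decompose : ∀ v → Set⟦ γ ∧′ (π ⇒′ φ ∧′ π) ⟧ v ⇔ Set⟦ φ ⟧ v
      decompose v = mk⇔
        (λ p → let v∈γ , p = to ∧-holds p in dne λ v∉φ →
           v∉φ (proj₁ (to ∧-holds (to ⇒-holds p (from π-holds
             (v , from ∧-holds (v∈γ , from ¬-holds v∉φ) , Agree-refl v))))))
        (λ v∈φ → from ∧-holds (from (close-holds _ φ) (⊆Close Set⟦ φ ⟧ v∈φ) ,
           from ⇒-holds λ v∈π → from ∧-holds (v∈φ , v∈π)))

    -- Implication generates all Boolean combinations, `⊥′` being closed. `equiv` makes this a
    -- property of the defined set, since `step` changes the formula.
    data Constructible (n : ℕ) {N : ℕ} : Formula L ⊥ N → Set (lsuc 0ℓ ⊔ f ⊔ r ⊔ s) where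
      closed : ∀ {φ} → Closed n Set⟦ φ ⟧ → Constructible n φ
      imp    : ∀ {φ ψ} → Constructible n φ → Constructible n ψ → Constructible n (φ ⇒′ ψ)
      equiv  : ∀ {φ ψ} → (∀ v → Set⟦ φ ⟧ v ⇔ Set⟦ ψ ⟧ v) → Constructible n φ → Constructible n ψ

    ⊥-constructible : Constructible n {N} ⊥′
    ⊥-constructible = closed λ v v∈ →
      let l , u , v∈B = box-around v
          _ , sat x∈⊥ , _ = v∈ l u (λ i _ → v∈B i)
      in ⊥-elim (lower x∈⊥)

    ∧-constructible : {φ ψ : Formula L ⊥ N} → Constructible n φ → Constructible n ψ →
                      Constructible n (φ ∧′ ψ)
    ∧-constructible p q = imp (imp p (imp q ⊥-constructible)) ⊥-constructible

    step : (k : Fin N) {φ : Formula L ⊥ N} → Constructible (toℕ k) φ → Constructible (ℕ.suc (toℕ k)) φ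
    step k {φ} (closed p) = equiv (decompose k φ p)
      (∧-constructible (closed (closure-closed k φ p))
        (imp (closed (π-closed k φ p)) (closed (φ∧π-closed k φ p))))
    step k (imp p q)   = imp (step k p) (step k q)
    step k (equiv e p) = equiv e (step k p)

    constructible-upto : ∀ {N} (φ : Formula L ⊥ N) n → n ℕ.≤ N → Constructible n φ
    -- For `n = 0` a box is no condition, so the corners `v` and `v` serve, and `Agree 0` is
    -- equality in all coordinates.
    constructible-upto φ ℕ.zero    _   = closed λ v v∈ →
      let x , x∈φ , _ , x≈v = v∈ v v (λ _ ()) in Holds-cong (λ i → x≈v i ℕ.z≤n) x∈φ
    constructible-upto φ (ℕ.suc n) n<N =
      subst (λ m → Constructible (ℕ.suc m) φ) (Fin.toℕ-fromℕ< n<N) (step (fromℕ< n<N)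
        (subst (λ m → Constructible m φ) (sym (Fin.toℕ-fromℕ< n<N))
          (constructible-upto φ n (ℕ.<⇒≤ n<N))))

    constructible : ∀ {N} (φ : Formula L ⊥ N) → Constructible N φ
    constructible φ = constructible-upto φ _ ℕ.≤-refl

  -- Realising cuts

  module Extension {L : Language f r} {D : Setoid c e} {D′ : Setoid c′ e′}
                   {M : Structure L D s} {M′ : Structure L D′ s′} (j : ElementaryExtension M M′) where
    private
      module D = Setoid D
      module D′ = Setoid D′

    ι : ∣ D ∣ → ∣ D′ ∣
    ι = Func.to (ElementaryExtension.embed j)

    transfer : {φ : Formula L ⊥ n} {v : Vector ∣ D ∣ n} →
               Holds M (λ ()) v φ ⇔ Holds M′ (λ ()) (ι ∘ v) φ
    transfer {φ = φ} {v} = mk⇔ (sat ∘ to (ElementaryExtension.elementary j φ v) ∘ unsat)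
                               (sat ∘ from (ElementaryExtension.elementary j φ v) ∘ unsat)

    -- The universal closure is a sentence, so its truth reaches tuples of `M′` outside the image of
    -- `ι`.
    transfer-∀ : (φ : Formula L ⊥ n) → (∀ v → Holds M (λ ()) v φ) → ∀ w → Holds M′ (λ ()) w φ
    transfer-∀ φ p = to (closure-holds {φ = φ})
      (Holds-cong (λ ()) (to transfer (from (closure-holds {nm = λ ()} {φ}) p)))

    ι-injective : ∀ {x y} → ι x D′.≈ ι y → x D.≈ y
    ι-injective {x} {y} p = to ≈-holds
      (from (transfer {φ = var zero ≈′ var (suc zero)} {x ∷ y ∷ []}) (from ≈-holds p))

    module _ (_≺′_ : Language.RelSym L 2) where

      _≺₁_ : ∣ D ∣ → ∣ D ∣ → Set s
      x ≺₁ y = Structure.rel M _≺′_ (x ∷ y ∷ [])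

      _≺₂_ : ∣ D′ ∣ → ∣ D′ ∣ → Set s′
      x ≺₂ y = Structure.rel M′ _≺′_ (x ∷ y ∷ [])

      ι-≺ : ∀ {x y} → x ≺₁ y ⇔ ι x ≺₂ ι y
      ι-≺ {x} {y} = mk⇔
        (λ p → to (less-holds _≺′_)
              (to (transfer {φ = less′ _≺′_ (var zero) (var (suc zero))} {x ∷ y ∷ []})
          (from (less-holds _≺′_) p)))
        (λ p → to (less-holds _≺′_)
              (from (transfer {φ = less′ _≺′_ (var zero) (var (suc zero))} {x ∷ y ∷ []})
          (from (less-holds _≺′_) p)))

      module Cut {κ : Setoid k₁ k₂} (highly : HighlySaturatedOver κ M M′)
                 (total : ∀ x y → x ≺₁ y ⊎ x D.≈ y ⊎ y ≺₁ x)
                 (≺-trans : ∀ {x y z} → x ≺₁ y → y ≺₁ z → x ≺₁ z)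
                 (C : Pred ∣ D ∣ ℓ) (split : ∀ {x y} → C x → ¬ C y → ∃ λ z → x ≺₁ z × z ≺₁ y) where

        Image : Pred ∣ D′ ∣ 0ℓ
        Image y = Resized (∃ λ x → ι x D′.≈ y)

        Image≼D : Sub D′ Image ≼ D
        Image≼D = record
          { to = preimage
          ; cong = λ {y} {z} y≈z → ι-injective
              (D′.trans (ι-preimage y) (D′.trans y≈z (D′.sym (ι-preimage z))))
          ; injective = λ {y} {z} p → D′.trans (D′.sym (ι-preimage y))
              (D′.trans (Func.cong (ElementaryExtension.embed j) p) (ι-preimage z))
          }
          where
          preimage : ∃ Image → ∣ D ∣
          preimage y = proj₁ (unresize (proj₂ y))
          ι-preimage : ∀ y → ι (preimage y) D′.≈ proj₁ y
          ι-preimage y = proj₂ (unresize (proj₂ y))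

        Image≺κ : Sub D′ Image ≺ κ
        Image≺κ = let D≼κ , κ⋠D = HighlySaturatedOver.above-domain highly in
          Compose.injection Image≼D D≼κ , λ κ≼Image → κ⋠D (Compose.injection κ≼Image Image≼D)

        constant : ∣ D ∣ → Term L (∃ Image) 1
        constant x = par (ι x , resize (x , D′.refl))

        -- The type of an element that fills the cut: above all of `C`, below all of its complement.
        data Bound : Formula L (∃ Image) 1 → Set (f ⊔ r ⊔ c ⊔ c′ ⊔ ℓ) where
          lower-bound : ∀ x → C x → Bound (less′ _≺′_ (constant x) (var zero))
          upper-bound : ∀ x → ¬ C x → Bound (less′ _≺′_ (var zero) (constant x))

        lower-bound-sat : ∀ {x z} → Sat M′ proj₁ (less′ _≺′_ (constant x) (var zero)) (z ∷ []) ⇔ ι x ≺₂ z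
        lower-bound-sat {x} {z} = mk⇔ (to holds ∘ sat) (unsat ∘ from holds)
          where holds = less-holds _≺′_ {M = M′} {nm = proj₁} {constant x} {var zero} {z ∷ []}

        upper-bound-sat : ∀ {x z} → Sat M′ proj₁ (less′ _≺′_ (var zero) (constant x)) (z ∷ []) ⇔ z ≺₂ ι x
        upper-bound-sat {x} {z} = mk⇔ (to holds ∘ sat) (unsat ∘ from holds)
          where holds = less-holds _≺′_ {M = M′} {nm = proj₁} {var zero} {constant x} {z ∷ []}

        larger : ∀ {x y} → C x → C y → ∃ λ m → C m × (∀ {z} → m ≺₁ z → x ≺₁ z × y ≺₁ z)
        larger {x} {y} x∈ y∈ with total x y
        ... | inj₁ x≺y = y , y∈ , λ y≺z → ≺-trans x≺y y≺z , y≺z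
        ... | inj₂ (inj₂ y≺x) = x , x∈ , λ x≺z → x≺z , ≺-trans y≺x x≺z
        ... | inj₂ (inj₁ x≈y) = x , x∈ , λ x≺z → x≺z ,
          Structure.rel-resp M _≺′_ (λ { zero → x≈y ; (suc zero) → D.refl }) x≺z

        smaller : ∀ {x y} → ¬ C x → ¬ C y → ∃ λ m → ¬ C m × (∀ {z} → z ≺₁ m → z ≺₁ x × z ≺₁ y)
        smaller {x} {y} x∉ y∉ with total x y
        ... | inj₁ x≺y = x , x∉ , λ z≺x → z≺x , ≺-trans z≺x x≺y
        ... | inj₂ (inj₂ y≺x) = y , y∉ , λ z≺y → ≺-trans z≺y y≺x , z≺y
        ... | inj₂ (inj₁ x≈y) = x , x∉ , λ z≺x → z≺x ,
          Structure.rel-resp M _≺′_ (λ { zero → D.refl ; (suc zero) → x≈y }) z≺x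

        -- Finitely many bounds reduce to the strictest lower and the strictest upper one; `x₀` and
        -- `y₀` take these roles for the empty list.
        finitely-satisfied : ∀ {x₀ y₀} → C x₀ → ¬ C y₀ → ∀ φs → All (Resized ∘ Bound) φs →
          ∃₂ λ x y → C x × ¬ C y × (∀ {z} → x ≺₁ z → z ≺₁ y → All (λ φ → Sat M′ proj₁ φ (ι z ∷ [])) φs)
        finitely-satisfied x₀∈ y₀∉ List.[] All.[] = _ , _ , x₀∈ , y₀∉ , λ _ _ → All.[]
        finitely-satisfied x₀∈ y₀∉ (φ List.∷ φs) (φ∈ All.∷ φs∈)
          with finitely-satisfied x₀∈ y₀∉ φs φs∈ | unresize φ∈
        ... | x , y , x∈ , y∉ , good | lower-bound c c∈ =
          let m , m∈ , >m = larger c∈ x∈ in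
          m , y , m∈ , y∉ , λ m≺z z≺y → let c≺z , x≺z = >m m≺z in
            from lower-bound-sat (to ι-≺ c≺z) All.∷ good x≺z z≺y
        ... | x , y , x∈ , y∉ , good | upper-bound c c∉ =
          let m , m∉ , <m = smaller c∉ y∉ in
          x , m , x∈ , m∉ , λ x≺z z≺m → let z≺c , z≺y = <m z≺m in
            from upper-bound-sat (to ι-≺ z≺c) All.∷ good x≺z z≺y

        realise-cut : ∀ {x₀ y₀} → C x₀ → ¬ C y₀ →
                      ∃ λ c → (∀ {x} → C x → ι x ≺₂ c) × (∀ {x} → ¬ C x → c ≺₂ ι x)
        realise-cut x₀∈ y₀∉ =
          let c , c∈ = HighlySaturatedOver.saturated highly Image Image≺κ (Resized ∘ Bound)
                λ φs φs∈ → let x , y , x∈ , y∉ , good = finitely-satisfied x₀∈ y₀∉ φs φs∈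
                               z , x≺z , z≺y = split x∈ y∉
                           in ι z , good x≺z z≺y
          in c , (λ x∈ → to lower-bound-sat (c∈ _ (resize (lower-bound _ x∈)))) ,
                 (λ x∉ → to upper-bound-sat (c∈ _ (resize (upper-bound _ x∉))))

  -- Standard parts

  abstract

    minimum-positive : ∀ n (ε : Vector ℝ n) → (∀ i → 0ℝ < ε i) → ∃ λ δ → 0ℝ < δ × (∀ i → δ < ε i)
    minimum-positive ℕ.zero    ε ε>0 = let q , 0<q = above 0ℝ in fromℚ q , 0<q , λ ()
    minimum-positive (ℕ.suc n) ε ε>0 =
      let δ , 0<δ , δ< = minimum-positive n (ε ∘ suc) (ε>0 ∘ suc)
          m , 0<m , <m = minimum-above 0<δ (ε>0 zero)
          q , 0<q , q<m = between 0<m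
          q<δ , q<ε = <m q<m
      in fromℚ q , 0<q , λ { zero → q<ε ; (suc i) → <-trans q<δ (δ< i) }

  module StandardPart
    {L : Language f r} (𝓡 : Structure L ℝ-setoid s) (E : Expansion ℝ<+ 𝓡)
    {D : Setoid c e} (𝓝 : Structure L D s′) (i : ElementaryExtension 𝓡 𝓝) where

    open Constructibility 𝓡 E using (<-holds; ⋖⇔<; Set⟦_⟧; ≡⇒≈)
    open Extension i public
    private module D = Setoid D
    open Setoid D using (_≈_)

    infix 4 _⋖_
    _⋖_ : ∣ D ∣ → ∣ D ∣ → Set s′
    _⋖_ = order E 𝓝

    lt : Language.RelSym L 2
    lt = Expansion.relMap E less

    _+′_ : Term L A n → Term L A n → Term L A n
    t +′ u = app (Expansion.funMap E plus) (t ∷ u ∷ [])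

    _⊕_ : ∣ D ∣ → ∣ D ∣ → ∣ D ∣
    x ⊕ y = Structure.fun 𝓝 (Expansion.funMap E plus) (x ∷ y ∷ [])

    value-+ : {nm : A → ∣ D ∣} {t u : Term L A n} {v : Vector ∣ D ∣ n} →
              value 𝓝 nm (t +′ u) v ≈ (value 𝓝 nm t v ⊕ value 𝓝 nm u v)
    value-+ = Structure.fun-cong 𝓝 _ λ { zero → D.refl ; (suc zero) → D.refl }

    +ℝ-value : (t u : Term L ⊥ n) (v : Vector ℝ n) →
               (value 𝓡 (λ ()) t v +ℝ value 𝓡 (λ ()) u v) ≈ℝ value 𝓡 (λ ()) (t +′ u) v
    +ℝ-value t u v = ≈ℝ-sym {value 𝓡 (λ ()) (t +′ u) v} {x +ℝ y}
      (≈ℝ-trans {value 𝓡 (λ ()) (t +′ u) v} {Structure.fun 𝓡 _ (x ∷ y ∷ [])} {x +ℝ y}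
        (Structure.fun-cong 𝓡 _ λ { zero → ≈ℝ-refl {x} ; (suc zero) → ≈ℝ-refl {y} })
        (Expansion.fun-same E plus _))
      where
      x = value 𝓡 (λ ()) t v
      y = value 𝓡 (λ ()) u v

    ⋖-holds : {nm : A → ∣ D ∣} {t u : Term L A n} {v : Vector ∣ D ∣ n} →
              Holds 𝓝 nm v (less′ lt t u) ⇔ value 𝓝 nm t v ⋖ value 𝓝 nm u v
    ⋖-holds = less-holds lt

    ⋖-resp : ∀ {x x′ y y′} → x ≈ x′ → y ≈ y′ → x ⋖ y → x′ ⋖ y′
    ⋖-resp x≈ y≈ = Structure.rel-resp 𝓝 lt λ { zero → x≈ ; (suc zero) → y≈ }

    private
      v₀ : Term L ⊥ (ℕ.suc n)
      v₀ = var zero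
      v₁ : Term L ⊥ (ℕ.suc (ℕ.suc n))
      v₁ = var (suc zero)
      v₂ : Term L ⊥ (ℕ.suc (ℕ.suc (ℕ.suc n)))
      v₂ = var (suc (suc zero))
      v₃ : Term L ⊥ (ℕ.suc (ℕ.suc (ℕ.suc (ℕ.suc n))))
      v₃ = var (suc (suc (suc zero)))
      infix 6 _≺′_
      _≺′_ : Term L ⊥ n → Term L ⊥ n → Formula L ⊥ n
      _≺′_ = less′ lt

    abstract

      ι-< : ∀ {x y} → x < y ⇔ ι x ⋖ ι y
      ι-< = mk⇔ (to (ι-≺ lt) ∘ from ⋖⇔<) (to ⋖⇔< ∘ from (ι-≺ lt))

      -- The laws of the ordered group are checked in ℝ as parameter-free formulas and reach `𝓝` by
      -- `transfer-∀`.
      ⋖-irrefl : ∀ {x} → ¬ x ⋖ x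
      ⋖-irrefl {x} x⋖x = to ¬-holds (transfer-∀ {n = 1} (¬′ (v₀ ≺′ v₀))
        (λ v → from ¬-holds λ p → <-irrefl (≈ℝ-refl {v zero}) (to (<-holds (λ ())) p))
        (x ∷ [])) (from ⋖-holds x⋖x)

      ⋖-trans : ∀ {x y z} → x ⋖ y → y ⋖ z → x ⋖ z
      ⋖-trans {x} {y} {z} x⋖y y⋖z = to ⋖-holds (to ⇒-holds (to ⇒-holds
        (transfer-∀ {n = 3} (v₀ ≺′ v₁ ⇒′ v₁ ≺′ v₂ ⇒′ v₀ ≺′ v₂)
          (λ v → from ⇒-holds λ p → from ⇒-holds λ q →
            from (<-holds (λ ())) (<-trans (to (<-holds (λ ())) p) (to (<-holds (λ ())) q)))
          (x ∷ y ∷ z ∷ [])) (from ⋖-holds x⋖y)) (from ⋖-holds y⋖z))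

      ⋖-asym : ∀ {x y} → x ⋖ y → ¬ y ⋖ x
      ⋖-asym x⋖y y⋖x = ⋖-irrefl (⋖-trans x⋖y y⋖x)

      ⋖-total : ∀ x y → x ⋖ y ⊎ x ≈ y ⊎ y ⋖ x
      ⋖-total x y with em _ {x ⋖ y} | em _ {y ⋖ x}
      ... | yes x⋖y | _       = inj₁ x⋖y
      ... | no _    | yes y⋖x = inj₂ (inj₂ y⋖x)
      ... | no x⋪y  | no y⋪x  = inj₂ (inj₁ (to ≈-holds (to ⇒-holds (to ⇒-holds
        (transfer-∀ {n = 2} (¬′ (v₀ ≺′ v₁) ⇒′ ¬′ (v₁ ≺′ v₀) ⇒′ v₀ ≈′ v₁)
          (λ v → from ⇒-holds λ p → from ⇒-holds λ q → from ≈-holds (≮-antisym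
            (to ¬-holds p ∘ from (<-holds (λ ()))) (to ¬-holds q ∘ from (<-holds (λ ())))))
          (x ∷ y ∷ [])) (from ¬-holds (x⋪y ∘ to ⋖-holds))) (from ¬-holds (y⋪x ∘ to ⋖-holds)))))

      ⋖-dense : ∀ {x y} → x ⋖ y → ∃ λ z → x ⋖ z × z ⋖ y
      ⋖-dense {x} {y} x⋖y =
        let z , p = to ∃-holds (to ⇒-holds (transfer-∀ {n = 2} (v₀ ≺′ v₁ ⇒′ ∃′ (v₁ ≺′ v₀ ∧′ v₀ ≺′ v₂))
              (λ v → from ⇒-holds λ p → let q , x<q , q<y = between (to (<-holds (λ ())) p) in
                from ∃-holds (fromℚ q , from ∧-holds
                  (from (<-holds (λ ())) x<q , from (<-holds (λ ())) q<y)))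
              (x ∷ y ∷ [])) (from ⋖-holds x⋖y))
            x⋖z , z⋖y = to ∧-holds p
        in z , to ⋖-holds x⋖z , to ⋖-holds z⋖y

      ⊕-mono : ∀ {x y z w} → x ⋖ y → z ⋖ w → x ⊕ z ⋖ y ⊕ w
      ⊕-mono {x} {y} {z} {w} x⋖y z⋖w = ⋖-resp value-+ value-+ (to
        (⋖-holds {t = v₀ +′ v₂} {v₁ +′ v₃}) (to ⇒-holds (to ⇒-holds
        (transfer-∀ {n = 4} (v₀ ≺′ v₁ ⇒′ v₂ ≺′ v₃ ⇒′ (v₀ +′ v₂) ≺′ (v₁ +′ v₃))
          (λ v → from ⇒-holds λ p → from ⇒-holds λ q → from (<-holds (λ ()))
            (<-resp (+ℝ-value v₀ v₂ v) (+ℝ-value v₁ v₃ v)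
              (+ℝ-mono-< (to (<-holds (λ ())) p) (to (<-holds (λ ())) q))))
          (x ∷ y ∷ z ∷ w ∷ [])) (from ⋖-holds x⋖y)) (from ⋖-holds z⋖w)))

      ι-<+ : ∀ {x y z} → x < (y +ℝ z) → ι x ⋖ ι y ⊕ ι z
      ι-<+ {x} {y} {z} p = ⋖-resp D.refl value-+ (to (⋖-holds {t = v₀} {v₁ +′ v₂}) (to transfer
        (from (<-holds (λ ()) {t = v₀} {v₁ +′ v₂} {x ∷ y ∷ z ∷ []})
          (<-resp (≈ℝ-refl {x}) (+ℝ-value v₁ v₂ (x ∷ y ∷ z ∷ [])) p))))

      ι-+< : ∀ {x y z} → (y +ℝ z) < x → ι y ⊕ ι z ⋖ ι x
      ι-+< {x} {y} {z} p = ⋖-resp value-+ D.refl (to (⋖-holds {t = v₁ +′ v₂} {v₀}) (to transfer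
        (from (<-holds (λ ()) {t = v₁ +′ v₂} {v₀} {x ∷ y ∷ z ∷ []})
          (<-resp (+ℝ-value v₁ v₂ (x ∷ y ∷ z ∷ [])) (≈ℝ-refl {x}) p))))

      ⋖-≮-trans : ∀ {x y z} → x ⋖ z → ¬ y ⋖ z → x ⋖ y
      ⋖-≮-trans {x} {y} {z} x⋖z y⋪z with ⋖-total z y
      ... | inj₁ z⋖y        = ⋖-trans x⋖z z⋖y
      ... | inj₂ (inj₁ z≈y) = ⋖-resp D.refl z≈y x⋖z
      ... | inj₂ (inj₂ y⋖z) = ⊥-elim (y⋪z y⋖z)

      ≮-⋖-trans : ∀ {x y z} → ¬ z ⋖ x → z ⋖ y → x ⋖ y
      ≮-⋖-trans {x} {y} {z} z⋪x z⋖y with ⋖-total x z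
      ... | inj₁ x⋖z        = ⋖-trans x⋖z z⋖y
      ... | inj₂ (inj₁ x≈z) = ⋖-resp (D.sym x≈z) D.refl z⋖y
      ... | inj₂ (inj₂ z⋖x) = ⊥-elim (z⋪x z⋖x)

    Finite : Pred ∣ D ∣ _
    Finite x = ∃ (λ r → ι r ⋖ x) × ∃ (λ r → x ⋖ ι r)

    -- Asking for a larger rational `q′` below `x`, instead of `q` itself, leaves the cut without a
    -- greatest element even if `x` is infinitesimally above a rational.
    st : ∀ x → Finite x → ℝ
    cut (st x _) q = Resized (∃ λ q′ → q ℚ.< q′ × ι (fromℚ q′) ⋖ x)
    inhabited (st x ((l , l⋖x) , _)) =
      let q′ , q′<l = below l; q , q<q′ = below (fromℚ q′) in
      q , resize (q′ , fromℚ<⇒∈ (fromℚ q′) q<q′ , ⋖-trans (to ι-< q′<l) l⋖x)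
    bounded (st x (_ , (u , x⋖u))) =
      let q , u<q = above u in q , λ q∈ → let q′ , q<q′ , q′⋖x = unresize q∈ in
      <-asym (<-trans u<q (fromℚ-mono-< q<q′)) (from ι-< (⋖-trans q′⋖x x⋖u))
    downward (st x _) p<q q∈ =
      let q′ , q<q′ , q′⋖x = unresize q∈ in resize (q′ , ℚ.<-trans p<q q<q′ , q′⋖x)
    noMax (st x _) q∈ =
      let q′ , q<q′ , q′⋖x = unresize q∈; m , q<m , m<q′ = ℚ.<-dense q<q′ in
      m , q<m , resize (q′ , m<q′ , q′⋖x)

    abstract

      -- Only strict inequalities with reals pass from the standard part to `x`: where the standard
      -- part equals `r`, `x` may lie on either side of `ι r`.
      <st⇒⋖ : ∀ {x} (x-fin : Finite x) {r} → r < st x x-fin → ι r ⋖ x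
      <st⇒⋖ x-fin {r} (mk (q , q∉ , q∈)) = let q′ , q<q′ , q′⋖x = unresize q∈ in
        ⋖-trans (to ι-< (∉⇒<fromℚ r q∉ q<q′)) q′⋖x

      st<⇒⋖ : ∀ {x} (x-fin : Finite x) {r} → st x x-fin < r → x ⋖ ι r
      st<⇒⋖ x-fin {r} (mk (q , q∉ , q∈)) = let q′ , q<q′ , q′∈ = noMax r q∈ in
        ≮-⋖-trans (λ q′⋖x → q∉ (resize (q′ , q<q′ , q′⋖x))) (to ι-< (∈⇒fromℚ< r q′∈))

    -- Nearness to a definable set

    module _ (φ : Formula L ⊥ n) where

      -- Maximum-norm distance below `h` to some point of the set, phrased by addition because `+`
      -- and `<` are what the expansion guarantees.
      Near : ∣ D ∣ → Vector ∣ D ∣ n → Set _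
      Near h a = ∃ λ b → Holds 𝓝 (λ ()) b φ × (∀ i → b i ⋖ a i ⊕ h × a i ⋖ b i ⊕ h)

      near′ : Formula L ⊥ (ℕ.suc n)
      near′ = ∃ⁿ n (sub (λ ()) (λ i → var (i ↑ˡ _)) φ ∧′ ⋀ λ i →
        (var (i ↑ˡ _) ≺′ (var (n ↑ʳ suc i) +′ var (n ↑ʳ zero))) ∧′
        (var (n ↑ʳ suc i) ≺′ (var (i ↑ˡ _) +′ var (n ↑ʳ zero))))

      abstract

        near-holds : ∀ {h a} → Holds 𝓝 (λ ()) (h ∷ a) near′ ⇔ Near h a
        near-holds {h} {a} = mk⇔
          (λ p → let b , p = to (∃ⁿ-holds n) p
                     b∈ , p = to ∧-holds p
                     b≡ = D.reflexive ∘ lookup-++ˡ b (h ∷ a)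
                     a≡ = D.reflexive ∘ lookup-++ʳ b (h ∷ a)
                 in b , to (rename-holds b≡) b∈ , λ i → let q , q′ = to ∧-holds (to ⋀-holds p i) in
                    ⋖-resp (b≡ i) (D.trans value-+ (⊕-cong (a≡ (suc i)) (a≡ zero))) (to ⋖-holds q) ,
                    ⋖-resp (a≡ (suc i)) (D.trans value-+ (⊕-cong (b≡ i) (a≡ zero))) (to ⋖-holds q′))
          (λ (b , b∈ , near) →
            let b≡ = D.reflexive ∘ lookup-++ˡ b (h ∷ a)
                a≡ = D.reflexive ∘ lookup-++ʳ b (h ∷ a)
            in from (∃ⁿ-holds n) (b , from ∧-holds (from (rename-holds b≡) b∈ , from ⋀-holds λ i →
                 from ∧-holds
                   ( from ⋖-holds (⋖-resp (D.sym (b≡ i))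
                       (D.sym (D.trans value-+ (⊕-cong (a≡ (suc i)) (a≡ zero)))) (proj₁ (near i)))
                   , from ⋖-holds (⋖-resp (D.sym (a≡ (suc i)))
                       (D.sym (D.trans value-+ (⊕-cong (b≡ i) (a≡ zero)))) (proj₂ (near i)))))))
          where
          ⊕-cong : ∀ {x x′ y y′} → x ≈ x′ → y ≈ y′ → x ⊕ y ≈ x′ ⊕ y′
          ⊕-cong x≈ y≈ = Structure.fun-cong 𝓝 _ λ { zero → x≈ ; (suc zero) → y≈ }

      module _ {a : Vector ∣ D ∣ n} (a-fin : ∀ i → Finite (a i)) where

        sta : Vector ℝ n
        sta i = st (a i) (a-fin i)

        -- The standard part itself is the required point: by elementarity it lies in the set, and
        -- its distance from `a` is below every positive real.
        st∈⇒near : Set⟦ φ ⟧ sta → ∀ {h ε} → 0ℝ < ε → ι ε ⋖ h → Near h a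
        st∈⇒near p {h} {ε} 0<ε ε⋖h = ι ∘ sta , to transfer p , λ i →
          let l , u , l<st , st<u , u<l+ε = approximate (sta i) 0<ε
          in ⋖-trans (to ι-< st<u) (⋖-trans (ι-<+ u<l+ε) (⊕-mono (<st⇒⋖ (a-fin i) l<st) ε⋖h)) ,
             ⋖-trans (st<⇒⋖ (a-fin i) st<u) (⋖-trans (ι-<+ u<l+ε) (⊕-mono (to ι-< l<st) ε⋖h))

        -- Forces every point near enough to `a` into a given real box around the standard part;
        -- `gap` on either side supplies the tolerance.
        inside-tolerance : ∀ {l u} i → Inside l u (sta i) →
          ∃ λ ε → 0ℝ < ε × (∀ {h b} → h ⋖ ι ε → b ⋖ a i ⊕ h → a i ⋖ b ⊕ h → ι l ⋖ b × b ⋖ ι u)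
        inside-tolerance {l} {u} i (l<st , st<u) =
          -- Failure of `ι l ⋖ b` gives only that `b` is at most `ι l`, so the margin is measured
          -- from `l₁`, strictly above `l`.
          let l₁ , l<l₁ , l₁<st = between l<st
              l₂ , l₁<l₂ , l₂<st = between l₁<st
              ε₁ , 0<ε₁ , l₁+ε₁<l₂ = gap l₁<l₂
              u₁ , st<u₁ , u₁<u = between st<u
              ε₂ , 0<ε₂ , u₁+ε₂<u = gap u₁<u
              m , 0<m , <m = minimum-above 0<ε₁ 0<ε₂
              ε , 0<ε , ε<m = between 0<m
              ε<ε₁ , ε<ε₂ = <m ε<m
          in fromℚ ε , 0<ε , λ h⋖ε b⋖a+h a⋖b+h →
               dne (λ l⋪b → ⋖-asym a⋖b+h (⋖-trans
                 (⊕-mono (≮-⋖-trans l⋪b (to ι-< l<l₁)) (⋖-trans h⋖ε (to ι-< ε<ε₁)))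
                 (⋖-trans (ι-+< l₁+ε₁<l₂) (<st⇒⋖ (a-fin i) l₂<st)))) ,
               ⋖-trans b⋖a+h (⋖-trans
                 (⊕-mono (st<⇒⋖ (a-fin i) st<u₁) (⋖-trans h⋖ε (to ι-< ε<ε₂)))
                 (ι-+< u₁+ε₂<u))

        meets-box′ : Formula L ⊥ (n ℕ.+ n)
        meets-box′ = ∃ⁿ n (sub (λ ()) (λ i → var (i ↑ˡ _)) φ ∧′ ⋀ λ i →
          (var (n ↑ʳ (i ↑ˡ n)) ≺′ var (i ↑ˡ _)) ∧′ (var (i ↑ˡ _) ≺′ var (n ↑ʳ (n ↑ʳ i))))

        -- A real box around the standard part contains, for small `h`, the point of the set near
        -- `a`. That the set meets this box descends to ℝ, and closedness finishes.
        near⇒st∈ : Closed n Set⟦ φ ⟧ → (∀ {δ} → 0ℝ < δ → ∃ λ h → h ⋖ ι δ × Near h a) → Set⟦ φ ⟧ sta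
        near⇒st∈ φ-closed near = φ-closed sta λ l u st∈ →
          let tolerance = λ i → inside-tolerance i (st∈ i (Fin.toℕ<n i))
              δ , 0<δ , δ<ε = minimum-positive n (proj₁ ∘ tolerance) (λ i → proj₁ (proj₂ (tolerance i)))
              h , h⋖δ , b , b∈ , b≈a = near 0<δ
              b-in = λ i → proj₂ (proj₂ (tolerance i)) (⋖-trans h⋖δ (to ι-< (δ<ε i)))
                (proj₁ (b≈a i)) (proj₂ (b≈a i))
              b≡ = D.reflexive ∘ lookup-++ˡ b (ι ∘ (l ++ u))
              l≡ = λ i → D.reflexive
                (trans (lookup-++ʳ b (ι ∘ (l ++ u)) (i ↑ˡ n)) (cong ι (lookup-++ˡ l u i)))
              u≡ = λ i → D.reflexive
                (trans (lookup-++ʳ b (ι ∘ (l ++ u)) (n ↑ʳ i)) (cong ι (lookup-++ʳ l u i)))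
              -- Only the corners of the box enter as parameters, and they are real, so elementarity
              -- applies downwards.
              x , p = to (∃ⁿ-holds n) (from (transfer {φ = meets-box′} {l ++ u})
                (from (∃ⁿ-holds n) (b , from ∧-holds (from (rename-holds b≡) b∈ ,
                  from ⋀-holds λ i → from ∧-holds
                  ( from ⋖-holds (⋖-resp (D.sym (l≡ i)) (D.sym (b≡ i)) (proj₁ (b-in i)))
                  , from ⋖-holds (⋖-resp (D.sym (b≡ i)) (D.sym (u≡ i)) (proj₂ (b-in i))))))))
              x∈ , p = to ∧-holds p
              x≡ = lookup-++ˡ x (l ++ u)
              l≡ = λ i → trans (lookup-++ʳ x (l ++ u) (i ↑ˡ n)) (lookup-++ˡ l u i)
              u≡ = λ i → trans (lookup-++ʳ x (l ++ u) (n ↑ʳ i)) (lookup-++ʳ l u i)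
          in x , to (rename-holds (λ i → ≡⇒≈ (x≡ i))) x∈ ,
             (λ i _ → let q , q′ = to ∧-holds (to ⋀-holds p i) in
                subst₂ _<_ (l≡ i) (x≡ i) (to (<-holds (λ ())) q) ,
                subst₂ _<_ (x≡ i) (u≡ i) (to (<-holds (λ ())) q′)) ,
             λ i n≤i → ⊥-elim (ℕ.<⇒≱ (Fin.toℕ<n i) n≤i)

  -- Relations of the Shelah expansion

  module OnSubset
    {L : Language f r} {N : Setoid cN eN} (𝓝 : Structure L N sN) (lt : Language.RelSym L 2)
    (H : Pred ∣ N ∣ h)
    {H* : Setoid c* e*} (𝓗* : Structure (InducedLanguage L N) H* s*)
    (j : ElementaryExtension (InducedOn 𝓝 H) 𝓗*) where

    private
      module N = Setoid N
      module J = Extension j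

      𝓗 = InducedOn 𝓝 H
      𝓢 = Shelah 𝓗 𝓗* j

      LS : Language _ _
      LS = InducedLanguage (InducedLanguage L N) H*

    _⋖_ : ∣ N ∣ → ∣ N ∣ → Set sN
    x ⋖ y = Structure.rel 𝓝 lt (x ∷ y ∷ [])

    -- Two layers of naming: a relation symbol of `𝓗` is a formula over `𝓝`, and a relation symbol
    -- of the Shelah expansion is a formula over `𝓗*`, here an atomic one.
    trace′ : Formula L ⊥ n → Formula LS (∃ H) n
    trace′ φ = rel′ (rel′ (sub (λ ()) var φ) var) var

    trace-holds : ∀ {φ : Formula L ⊥ n} {v} → Holds 𝓢 id v (trace′ φ) ⇔ Holds 𝓝 (λ ()) (proj₁ ∘ v) φ
    trace-holds {φ = φ} {v} = mk⇔
      (λ (sat (lift (lift p))) → to rename (sat (lower (unsat (from atom (sat (lift p)))))))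
      (λ p → sat (lift (lift (lower (unsat (to atom (sat (lift (unsat (from rename p))))))))))
      where
      rename = rename-holds {M = 𝓝} {nm = id} {φ} {var} {proj₁ ∘ v} {proj₁ ∘ v} (λ _ → N.refl)
      atom = J.transfer {φ = rel′ (sub (λ ()) var φ) var} {v}

    module _ {κ* : Setoid k₁* k₂*} (highly* : HighlySaturatedOver κ* 𝓗 𝓗*)
      (⋖-trans : ∀ {x y z} → x ⋖ y → y ⋖ z → x ⋖ z) (⋖-asym : ∀ {x y} → x ⋖ y → ¬ y ⋖ x)
      (⋖-total : ∀ x y → x ⋖ y ⊎ x N.≈ y ⊎ y ⋖ x)
      (H-between : ∀ {x y} → x ⋖ y → ∃ λ (z : ∃ H) → x ⋖ proj₁ z × proj₁ z ⋖ y) where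

      lt* : Language.RelSym (InducedLanguage L N) 2
      lt* = less′ lt (var zero) (var (suc zero))

      _◂_ : ∃ H → ∃ H → Set _
      x ◂ y = Structure.rel 𝓗 lt* (x ∷ y ∷ [])

      ◂⇔⋖ : ∀ {x y} → x ◂ y ⇔ proj₁ x ⋖ proj₁ y
      ◂⇔⋖ {x} {y} = mk⇔ (to holds ∘ sat) (unsat ∘ from holds)
        where holds = less-holds lt {M = 𝓝} {nm = id} {var zero} {var (suc zero)} {proj₁ ∘ (x ∷ y ∷ [])}

      ◂-total : ∀ x y → x ◂ y ⊎ proj₁ x N.≈ proj₁ y ⊎ y ◂ x
      ◂-total x y with ⋖-total (proj₁ x) (proj₁ y)
      ... | inj₁ x⋖y = inj₁ (from ◂⇔⋖ x⋖y)
      ... | inj₂ (inj₁ x≈y) = inj₂ (inj₁ x≈y)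
      ... | inj₂ (inj₂ y⋖x) = inj₂ (inj₂ (from ◂⇔⋖ y⋖x))

      ◂-trans : ∀ {x y z} → x ◂ y → y ◂ z → x ◂ z
      ◂-trans {x} {y} {z} p q = from (◂⇔⋖ {x} {z}) (⋖-trans (to (◂⇔⋖ {x} {y}) p) (to (◂⇔⋖ {y} {z}) q))

      *-asym : ∀ {x y} → Structure.rel 𝓗* lt* (x ∷ y ∷ []) → ¬ Structure.rel 𝓗* lt* (y ∷ x ∷ [])
      *-asym {x} {y} x≺y y≺x = to ¬-holds (to ⇒-holds (J.transfer-∀ {n = 2}
          (less′ lt* (var zero) (var (suc zero)) ⇒′ ¬′ less′ lt* (var (suc zero)) (var zero))
          (λ v → from ⇒-holds λ p → from ¬-holds λ q →
            ⋖-asym (to ◂⇔⋖ (to (less-holds lt*) p)) (to ◂⇔⋖ (to (less-holds lt*) q)))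
          (x ∷ y ∷ [])) (from (less-holds lt*) x≺y)) (from (less-holds lt*) y≺x)

      Definable : Pred (∃ H) ℓ → Set _
      Definable X = ∃ λ (ψ : Formula LS (∃ H) 1) → ∀ x → Holds 𝓢 id (x ∷ []) ψ ⇔ X x

      -- Saturation of `𝓗*` yields an element `c` filling the cut of `C`, and comparison with `c` is
      -- an externally definable condition. Density of `H` provides the points between members and
      -- non-members.
      cut-definable : (C : Pred (∃ H) ℓ) → (∀ {x y} → C x → ¬ C y → proj₁ x ⋖ proj₁ y) → Definable C
      cut-definable C C-initial with em _ {∃ C} | em _ {∃ λ y → ¬ C y}
      -- `realise-cut` asks for a point on each side, so the empty and the full cut are treated
      -- apart.
      ... | no empty | _ = ⊥′ , λ x → mk⇔ (λ p → ⊥-elim (lower (unsat p)))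
        (λ x∈ → ⊥-elim (empty (x , x∈)))
      ... | _ | no full = ¬′ ⊥′ , λ x → mk⇔ (λ _ → dne λ x∉ → full (x , x∉)) (λ _ → sat id)
      ... | yes (x₀ , x₀∈) | yes (y₀ , y₀∉) =
        let c , below-c , above-c = J.Cut.realise-cut lt* highly* ◂-total ◂-trans C split x₀∈ y₀∉ in
        rel′ (less′ lt* (var zero) (par c)) var , λ x → mk⇔
          (λ p → dne λ x∉ → *-asym (to (atom x c) p) (above-c x∉))
          (λ x∈ → from (atom x c) (below-c x∈))
        where
        split : ∀ {x y} → C x → ¬ C y → ∃ λ z → x ◂ z × z ◂ y
        split x∈ y∉ = let z , x⋖z , z⋖y = H-between (C-initial x∈ y∉) in z , from ◂⇔⋖ x⋖z , from ◂⇔⋖ z⋖y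
        atom : ∀ x c → Holds 𝓢 id (x ∷ []) (rel′ (less′ lt* (var zero) (par c)) var) ⇔
                       Structure.rel 𝓗* lt* (J.ι x ∷ c ∷ [])
        atom x c = mk⇔ (λ p → to holds (sat (lower (unsat p)))) (λ p → sat (lift (unsat (from holds p))))
          where holds = less-holds lt* {M = 𝓗*} {nm = id} {var zero} {par c} {J.ι ∘ (x ∷ [])}

  -- The interpretation

  -- S stands for H, 𝓢 for the Shelah expansion of 𝓗, and η for the inclusion of H in N.

  module Interpretation
    {L : Language f r} (𝓡 : Structure L ℝ-setoid s) (E : Expansion ℝ<+ 𝓡) (omin : OMinimal 𝓡 (order E 𝓡))
    {N : Setoid cN eN} (𝓝 : Structure L N sN) (i : ElementaryExtension 𝓡 𝓝)
    {S : Setoid c e} (η : ∣ S ∣ → ∣ N ∣)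
    (S-between : ∀ {x y} → order E 𝓝 x y → ∃ λ z → order E 𝓝 x (η z) × order E 𝓝 (η z) y)
    {LS : Language f′ r′} (𝓢 : Structure LS S s′)
    (trace : ∀ {n} (φ : Formula L ⊥ n) →
      ∃ λ (ψ : Formula LS ∣ S ∣ n) → ∀ {v} → Holds 𝓢 id v ψ ⇔ Holds 𝓝 (λ ()) (η ∘ v) φ)
    (cut-definable : (C : Pred ∣ S ∣ (lsuc 0ℓ ⊔ sN)) → (∀ {x y} → C x → ¬ C y → order E 𝓝 (η x) (η y)) →
      ∃ λ (ψ : Formula LS ∣ S ∣ 1) → ∀ x → Holds 𝓢 id (x ∷ []) ψ ⇔ C x) where

    open Constructibility 𝓡 E using (Set⟦_⟧; ⋖⇔<; ≡⇒≈)
    open Step 𝓡 E omin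
    open StandardPart 𝓡 E 𝓝 i
    private
      module N = Setoid N
      module S = Setoid S

    Definable : Pred ∣ S ∣ ℓ → Set _
    Definable X = ∃ λ (ψ : Formula LS ∣ S ∣ 1) → ∀ x → Holds 𝓢 id (x ∷ []) ψ ⇔ X x

    unbounded-above unbounded-below : Pred ∣ S ∣ _
    unbounded-above x = ∀ r → ¬ η x ⋖ ι r
    unbounded-below x = ∀ r → ¬ ι r ⋖ η x

    not-positive : Pred ∣ S ∣ _
    not-positive x = ∀ ε → 0ℝ < ε → ¬ ι ε ⋖ η x

    bounded-above-definable : Definable (λ x → ¬ unbounded-above x)
    bounded-above-definable = cut-definable _ λ x∈ y∉ →
      let r , x⋖r = ¬∀⇒∃¬ x∈ in ⋖-≮-trans (dne x⋖r) (dne y∉ r)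

    unbounded-below-definable : Definable unbounded-below
    unbounded-below-definable = cut-definable _ λ x∈ y∉ →
      let r , r⋖y = ¬∀⇒∃¬ y∉ in ≮-⋖-trans (x∈ r) (dne r⋖y)

    not-positive-definable : Definable not-positive
    not-positive-definable = cut-definable _ λ x∈ y∉ → dne λ x⋪y →
      y∉ λ ε 0<ε ε⋖y → x⋪y (≮-⋖-trans (x∈ ε 0<ε) ε⋖y)

    finite′ : Formula LS ∣ S ∣ 1
    finite′ = proj₁ bounded-above-definable ∧′ ¬′ proj₁ unbounded-below-definable

    finite-holds : ∀ {x} → Holds 𝓢 id (x ∷ []) finite′ ⇔ Finite (η x)
    finite-holds {x} = mk⇔
      (λ p → let q , q′ = to ∧-holds p
                 u , x⋖u = ¬∀⇒∃¬ (to (proj₂ bounded-above-definable x) q)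
                 l , l⋖x = ¬∀⇒∃¬ (to ¬-holds q′ ∘ from (proj₂ unbounded-below-definable x))
             in (l , dne l⋖x) , (u , dne x⋖u))
      (λ ((l , l⋖x) , (u , x⋖u)) → from ∧-holds
        ( from (proj₂ bounded-above-definable x) (λ large → large u x⋖u)
        , from ¬-holds λ q → to (proj₂ unbounded-below-definable x) q l l⋖x))

    S-st : (x : ∣ S ∣) → Finite (η x) → ℝ
    S-st x = st (η x)

    PreimageDefinable : Pred (Vector ℝ n) ℓ → Set _
    PreimageDefinable {n = n} X = ∃ λ (ψ : Formula LS ∣ S ∣ n) →
      ∀ (a : Vector ∣ S ∣ n) (a-fin : ∀ i → Finite (η (a i))) →
      X (λ i → S-st (a i) (a-fin i)) ⇔ Holds 𝓢 id a ψ

    -- Stronger than being positive in `𝓝`: positive infinitesimals are excluded.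
    Positive : Pred ∣ S ∣ _
    Positive x = ∃ λ ε → 0ℝ < ε × ι ε ⋖ η x

    ¬not-positive⇒positive : ∀ {x} → ¬ not-positive x → Positive x
    ¬not-positive⇒positive ¬np = dne λ ¬pos → ¬np λ ε 0<ε ε⋖x → ¬pos (ε , 0<ε , ε⋖x)

    positive′ : Formula LS ∣ S ∣ (ℕ.suc n)
    positive′ = ¬′ sub id (λ _ → var zero) (proj₁ not-positive-definable)

    positive-holds : ∀ {x} {a : Vector ∣ S ∣ n} → Holds 𝓢 id (x ∷ a) positive′ ⇔ Positive x
    positive-holds {x = x} = mk⇔
      (λ p → ¬not-positive⇒positive λ q → to ¬-holds p
        (from rename (from (proj₂ not-positive-definable x) q)))
      (λ (ε , 0<ε , ε⋖x) → from ¬-holds λ q →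
        to (proj₂ not-positive-definable x) (to rename q) ε 0<ε ε⋖x)
      where
      rename : ∀ {x} {a : Vector ∣ S ∣ n} {φ} →
               Holds 𝓢 id (x ∷ a) (sub id (λ _ → var zero) φ) ⇔ Holds 𝓢 id (x ∷ []) φ
      rename = mk⇔ (λ p → Holds-cong (λ { zero → S.refl }) (to (sub-holds 𝓢 id id id (λ _ → S.refl)) p))
                   (λ p → from (sub-holds 𝓢 id id id (λ _ → S.refl))
                     (Holds-cong (λ { zero → S.refl }) p))

    module _ (φ : Formula L ⊥ n) where

      near-trace : Formula LS ∣ S ∣ (ℕ.suc n)
      near-trace = proj₁ (trace (near′ φ))

      near-trace-holds : ∀ {x a} → Holds 𝓢 id (x ∷ a) near-trace ⇔ Near φ (η x) (η ∘ a)
      near-trace-holds {x} {a} = mk⇔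
        (λ p → to (near-holds φ)
          (Holds-cong {φ = near′ φ} (λ { zero → N.refl ; (suc i) → N.refl }) (to holds p)))
        (λ p → from holds
          (Holds-cong {φ = near′ φ} (λ { zero → N.refl ; (suc i) → N.refl }) (from (near-holds φ) p)))
        where
        holds : Holds 𝓢 id (x ∷ a) near-trace ⇔ Holds 𝓝 (λ ()) (η ∘ (x ∷ a)) (near′ φ)
        holds = proj₂ (trace (near′ φ))

      positive-near : ∀ {δ} → 0ℝ < δ → ∃ λ x → Positive x × η x ⋖ ι δ
      positive-near 0<δ =
        let ε , 0<ε , ε<δ = between 0<δ
            x , ε⋖x , x⋖δ = S-between (to ι-< ε<δ)
        in x , (fromℚ ε , 0<ε , ε⋖x) , x⋖δ

      -- The two halves are `st∈⇒near`, for which `h` must exceed a positive real, and `near⇒st∈`,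
      -- which uses that such `h` occur in S below any given positive real.
      closed-preimage : Closed n Set⟦ φ ⟧ → PreimageDefinable Set⟦ φ ⟧
      closed-preimage φ-closed = ∀′ (positive′ ⇒′ near-trace) , λ a a-fin → mk⇔
        (λ a∈ → from ∀-holds λ x → from ⇒-holds λ x>0 →
          from near-trace-holds (near a-fin a∈ (to positive-holds x>0)))
        (λ p → near⇒st∈ φ a-fin φ-closed λ 0<δ → small (λ x x>0 → to near-trace-holds
          (to ⇒-holds (to ∀-holds p x) (from positive-holds x>0))) (positive-near 0<δ))
        where
        near : ∀ {a x} a-fin → Set⟦ φ ⟧ (λ i → S-st (a i) (a-fin i)) → Positive x → Near φ (η x) (η ∘ a)
        near a-fin a∈ (ε , 0<ε , ε⋖x) = st∈⇒near φ a-fin a∈ 0<ε ε⋖x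
        small : ∀ {δ a} → (∀ x → Positive x → Near φ (η x) (η ∘ a)) →
                (∃ λ x → Positive x × η x ⋖ ι δ) → ∃ λ h → h ⋖ ι δ × Near φ h (η ∘ a)
        small p (x , x>0 , x⋖δ) = η x , x⋖δ , p x x>0

    constructible-preimage : {φ : Formula L ⊥ n} → Constructible n φ → PreimageDefinable Set⟦ φ ⟧
    constructible-preimage (closed φ-closed) = closed-preimage _ φ-closed
    constructible-preimage (imp p q) with constructible-preimage p | constructible-preimage q
    ... | ψ , ψ⇔ | χ , χ⇔ = ψ ⇒′ χ , λ a a-fin → mk⇔
      (λ x → from ⇒-holds λ y → to (χ⇔ a a-fin) (to ⇒-holds x (from (ψ⇔ a a-fin) y)))
      (λ x → from ⇒-holds λ y → from (χ⇔ a a-fin) (to ⇒-holds x (to (ψ⇔ a a-fin) y)))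
    constructible-preimage (equiv φ⇔ψ p) with constructible-preimage p
    ... | χ , χ⇔ = χ , λ a a-fin → mk⇔ (to (χ⇔ a a-fin) ∘ from (φ⇔ψ _)) (to (φ⇔ψ _) ∘ from (χ⇔ a a-fin))

    preimage-definable : (φ : Formula L ⊥ n) → PreimageDefinable Set⟦ φ ⟧
    preimage-definable φ = constructible-preimage (constructible φ)

    module _ {κ : Setoid k₁ k₂} (highly : HighlySaturatedOver κ 𝓡 𝓝) where

      private
        total : ∀ x y → order E 𝓡 x y ⊎ x ≈ℝ y ⊎ order E 𝓡 y x
        total x y with <-cmp x y
        ... | inj₁ x<y = inj₁ (from ⋖⇔< x<y)
        ... | inj₂ (inj₁ x≈y) = inj₂ (inj₁ x≈y)
        ... | inj₂ (inj₂ y<x) = inj₂ (inj₂ (from ⋖⇔< y<x))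

        ⋖ℝ-trans : ∀ {x y z} → order E 𝓡 x y → order E 𝓡 y z → order E 𝓡 x z
        ⋖ℝ-trans {x} {y} {z} p q = from (⋖⇔< {x} {z}) (<-trans (to (⋖⇔< {x} {y}) p) (to (⋖⇔< {y} {z}) q))

        split : ∀ r {x y} → ¬ r < x → ¬ ¬ r < y → ∃ λ z → order E 𝓡 x z × order E 𝓡 z y
        split r {x} {y} r≮x r<y with between (dne r<y)
        ... | z , r<z , z<y = fromℚ z , from ⋖⇔< (dne λ x≮z → r≮x (<⊎≮⇒< r<z x≮z)) , from ⋖⇔< z<y

      -- The reals up to `r` form a cut of ℝ, and saturation of `𝓝` fills it.
      infinitesimally-above : ∀ r → ∃ λ c → ι r ⋖ c × (∀ {x} → r < x → c ⋖ ι x)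
      infinitesimally-above r with above r
      ... | q , r<q with Cut.realise-cut lt highly total ⋖ℝ-trans (λ x → ¬ r < x) (split r)
                           {r} {fromℚ q} (<-irrefl (≈ℝ-refl {r})) (λ r≮q → r≮q r<q)
      ...   | c , below-c , above-c = c , below-c {r} (<-irrefl (≈ℝ-refl {r})) ,
        λ r<x → above-c λ r≮x → r≮x r<x

      st-surjective : ∀ r → ∃₂ λ x x-fin → S-st x x-fin ≈ℝ r
      st-surjective r with infinitesimally-above r | above r
      -- Any element of S between `ι r` and `c` exceeds `ι r` by less than every positive real.
      ... | c , r⋖c , c⋖ | q , r<q with S-between r⋖c
      ...   | x , r⋖x , x⋖c = x , x-fin , ≮-antisym
          (λ st<r → ⋖-asym r⋖x (st<⇒⋖ x-fin st<r))
          (λ r<st → let p , r<p , p<st = between r<st in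
            ⋖-asym (<st⇒⋖ x-fin p<st) (⋖-trans x⋖c (c⋖ r<p)))
        where
        x-fin : Finite (η x)
        x-fin = (r , r⋖x) , (fromℚ q , ⋖-trans x⋖c (c⋖ r<q))

      interprets : Interprets 𝓢 𝓡
      interprets = record
        { m          = 1
        ; dom        = finite′
        ; coord      = coord
        ; surjective = λ r → let x , x-fin , st≈r = st-surjective r in
            (x ∷ []) , unsat (from finite-holds x-fin) , st≈r
        -- Equality, relations and graphs are given by parameter-free atomic formulas; in a graph,
        -- variable 0 is the value, as `head` prescribes.
        ; equality   = definable (var zero ≈′ var (suc zero)) (λ y → mk⇔ (from ≈-holds) (to ≈-holds))
        ; relations  = λ P → definable (rel′ P var) (λ y → mk⇔ (sat ∘ lift) (lower ∘ unsat))
        ; functions  = λ F → definable (app F (var ∘ suc) ≈′ var zero)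
          (λ y → mk⇔ (from ≈-holds) (to ≈-holds))
        }
        where
        finite : ∀ {x : Vector ∣ S ∣ 1} → Sat 𝓢 id finite′ x → Finite (η (x zero))
        finite p = to finite-holds (Holds-cong {φ = finite′} (λ { zero → S.refl }) (sat p))
        coord : (x : Vector ∣ S ∣ 1) → Sat 𝓢 id finite′ x → ℝ
        coord x p = S-st (x zero) (finite p)
        concat-single : ∀ {n} (x : Vector (Vector ∣ S ∣ 1) n) k → concat x (combine k zero) ≡ x k zero
        concat-single x k = cong (λ (k , l) → x k l) (Fin.remQuot-combine k zero)
        -- `n ℕ.* 1` does not reduce to `n`, so variable `k` is renamed to its position
        -- `combine k zero` in the concatenated tuple.
        definable : {X : Pred (Vector ℝ n) ℓ} (φ : Formula L ⊥ n) → (∀ y → X y ⇔ Set⟦ φ ⟧ y) →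
                    ∃ λ (ψ : Formula LS ∣ S ∣ (n ℕ.* 1)) →
                    ∀ (x : Vector (Vector ∣ S ∣ 1) n) (x∈ : ∀ k → Sat 𝓢 id finite′ (x k)) →
                    X (λ k → coord (x k) (x∈ k)) ⇔ Sat 𝓢 id ψ (concat x)
        definable φ X⇔φ = let ψ , ψ⇔ = preimage-definable φ in
          sub id (λ k → var (combine k zero)) ψ , λ x x∈ → mk⇔
            (λ p → unsat (from (sub-holds 𝓢 id id id (λ _ → S.refl))
              (Holds-cong {φ = ψ} (λ k → S.reflexive (sym (concat-single x k)))
                (to (ψ⇔ (λ k → x k zero) (λ k → finite (x∈ k))) (to (X⇔φ _) p)))))
            (λ p → from (X⇔φ _) (from (ψ⇔ (λ k → x k zero) (λ k → finite (x∈ k)))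
              (Holds-cong {φ = ψ} (λ k → S.reflexive (concat-single x k))
                (to (sub-holds 𝓢 id id id (λ _ → S.refl)) (sat p)))))

  -- Application to the dense set `H`

  module Shelah-interprets
    {L : Language f r} (𝓡 : Structure L ℝ-setoid s) (E : Expansion ℝ<+ 𝓡) (omin : OMinimal 𝓡 (order E 𝓡))
    {N : Setoid cN eN} (𝓝 : Structure L N sN) (i : ElementaryExtension 𝓡 𝓝)
    (H : Pred ∣ N ∣ h) (H-dense : Dense (order E 𝓝) H)
    {H* : Setoid c* e*} (𝓗* : Structure (InducedLanguage L N) H* s*)
    (j : ElementaryExtension (InducedOn 𝓝 H) 𝓗*) where

    open StandardPart 𝓡 E 𝓝 i using (_⋖_; lt; ⋖-trans; ⋖-asym; ⋖-total; ⋖-dense)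
    private
      module ± = Extrema _⋖_
      module 𝓢 = OnSubset 𝓝 lt H 𝓗* j

    H-between : ∀ {x y} → x ⋖ y → ∃ λ (z : ∃ H) → x ⋖ proj₁ z × proj₁ z ⋖ y
    -- `Dense` speaks of inhabited intervals, so a point of `𝓝` between `x` and `y` comes first.
    H-between {x} {y} x⋖y with ⋖-dense x⋖y
    ... | z , x⋖z , z⋖y with H-dense ([ x ] , [ y ]) (z , ±.[ x⋖z ] , ±.[ z⋖y ])
    ...   | z′ , z′∈H , x⋖z′ , z′⋖y = (z′ , z′∈H) , ±.[<]-injective x⋖z′ , ±.[<]-injective z′⋖y

    interpretation : {κ : Setoid k₁ k₂} → HighlySaturatedOver κ 𝓡 𝓝 →
                     {κ* : Setoid k₁* k₂*} → HighlySaturatedOver κ* (InducedOn 𝓝 H) 𝓗* →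
                     Interprets (Shelah (InducedOn 𝓝 H) 𝓗* j) 𝓡
    interpretation highly highly* =
      Interpretation.interprets 𝓡 E omin 𝓝 i proj₁ H-between (Shelah (InducedOn 𝓝 H) 𝓗* j)
      (λ φ → 𝓢.trace′ φ , 𝓢.trace-holds) (𝓢.cut-definable highly* ⋖-trans ⋖-asym ⋖-total H-between) highly

proposition3p4 :
  (∀ ℓ → ExcludedMiddle ℓ) →
  ∀ {f r s cN eN sN k₁ k₂ h c* e* s* k₁* k₂* : Level} →
  -- 𝓡 is an o-minimal expansion of (ℝ,<,+)
  (L : Language f r) (𝓡 : Structure L ℝ-setoid s) (E : Expansion ℝ<+ 𝓡) →
  OMinimal 𝓡 (order E 𝓡) →
  -- 𝓝 is a highly saturated elementary extension of 𝓡
  (N : Setoid cN eN) (𝓝 : Structure L N sN) → ElementaryExtension 𝓡 𝓝 →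
  (κ : Setoid k₁ k₂) → HighlySaturatedOver κ 𝓡 𝓝 →
  -- H is a dense independent subset of N
  (H : Pred ∣ N ∣ h) → H Respects (Setoid._≈_ N) →
  Dense (order E 𝓝) H → Independent 𝓝 H →
  -- 𝓗* is a highly saturated elementary extension of 𝓗 = InducedOn 𝓝 H
  (H* : Setoid c* e*) (𝓗* : Structure (InducedLanguage L N) H* s*) →
  (j : ElementaryExtension (InducedOn 𝓝 H) 𝓗*) →
  (κ* : Setoid k₁* k₂*) → HighlySaturatedOver κ* (InducedOn 𝓝 H) 𝓗* →
  Interprets (Shelah (InducedOn 𝓝 H) 𝓗* j) 𝓡
proposition3p4 em L 𝓡 E omin N 𝓝 i κ highly H _ H-dense _ H* 𝓗* j κ* highly* =
  Classical.Shelah-interprets.interpretation em 𝓡 E omin 𝓝 i H H-dense 𝓗* j highly highly*
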